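{- Let $n\geq 1$ be a fixed integer and let $\mathcal{C}_n$ be the class of all finite $n$-colorable graphs. Every $\mathbf{X}\in\mathcal{C}_n$ has a finite Ramsey degree in $\mathcal{C}_n$ equal to $\tau(\mathbf{X})$. That is, $\tau(\mathbf{X})$ is the least integer $t$ such that for every $\mathbf{Y}\in\mathcal{C}_n$ and every $k\in\mathbb{N}$ there exists $\mathbf{Z}\in\mathcal{C}_n$ with $\mathbf{Z}\to(\mathbf{Y})^{\mathbf{X}}_{k,t}$.
   Context: Graphs are simple and loopless, viewed as structures $(X,E)$ with $E$ an irreflexive symmetric binary relation. $[n]=\{1,\dots,n\}$. $\mathcal{M}^<_n$ is the class of finite structures $(X,E,<,\lambda)$ where $(X,E)$ is a finite graph, $<$ a linear ordering of $X$, and $\lambda:X\to[n]$ a map with $\lambda(x)\neq\lambda(y)$ whenever $x,y$ are adjacent, which is moreover monotone: $x<y$ implies $\lambda(x)\leq\lambda(y)$. For $\mathbf{X}=(X,E^{\mathbf X})\in\mathcal{C}_n$, an extension of $\mathbf{X}$ in $\mathcal{M}^<_n$ is a structure $(X,E^{\mathbf X},<,\lambda)\in\mathcal{M}^<_n$; $\tau(\mathbf{X})$ is the number of pairwise non-isomorphic extensions of $\mathbf{X}$ in $\mathcal{M}^<_n$ (isomorphisms preserve edges, order and coloring). For graphs $\mathbf A,\mathbf B$, $\binom{\mathbf{B}}{\mathbf{A}}$ denotes the set of induced subgraphs of $\mathbf{B}$ isomorphic to $\mathbf{A}$. $\mathbf{Z}\to(\mathbf{Y})^{\mathbf{X}}_{k,t}$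 means: for every map $\alpha:\binom{\mathbf{Z}}{\mathbf{X}}\to[k]$ there is $\tilde{\mathbf{Y}}\in\binom{\mathbf{Z}}{\mathbf{Y}}$ such that $\alpha$ takes at most $t$ values on $\binom{\tilde{\mathbf{Y}}}{\mathbf{X}}$. -}

module Defs where

open import Data.Nat using (ℕ; _≤_)
open import Data.Bool using (Bool; true; false)
open import Data.Fin using (Fin) renaming (_<_ to _<ᶠ_; _≤_ to _≤ᶠ_)
open import Data.Fin.Subset using (Subset; _∈_; _⊆_; ∣_∣)
open import Data.Product using (Σ; ∃; _×_; _,_)
open import Relation.Binary.PropositionalEquality using (_≡_; _≢_)
open import Relation.Nullary using (¬_)
open import Function.Bundles using (_↔_; Inverse; _⇔_)
open import Function.Definitions using (Injective)

record Graph : Set where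
  field
    size  : ℕ
    E     : Fin size → Fin size → Bool
    sym   : ∀ x y → E x y ≡ E y x
    irrefl : ∀ x → E x x ≡ false
open Graph public

ProperColouring : (n : ℕ) (G : Graph) → (Fin (size G) → Fin n) → Set
ProperColouring n G c = ∀ x y → E G x y ≡ true → c x ≢ c y

Colourable : ℕ → Graph → Set
Colourable n G = Σ (Fin (size G) → Fin n) (ProperColouring n G)

IsEmbedding : (A B : Graph) → (Fin (size A) → Fin (size B)) → Set
IsEmbedding A B f = Injective _≡_ _≡_ f × (∀ a b → E A a b ≡ E B (f a) (f b))

IsCopy : (A B : Graph) → Subset (size B) → Set
IsCopy A B S = Σ (Fin (size A) → Fin (size B)) λ f →
  IsEmbedding A B f × (∀ z → (z ∈ S) ⇔ (∃ λ a → f a ≡ z))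

-- A colouring α : binom(Z, X) → [k].  It takes a copy S together with a
-- witness that it is a copy, and must not depend on that witness.
record CopyColouring (X Z : Graph) (k : ℕ) : Set where
  field
    col        : (S : Subset (size Z)) → IsCopy X Z S → Fin k
    witness-irrelevant : ∀ S (p q : IsCopy X Z S) → col S p ≡ col S q
open CopyColouring public

Arrow : (Z Y X : Graph) (k t : ℕ) → Set
Arrow Z Y X k t =
  (α : CopyColouring X Z k) →
  Σ (Subset (size Z)) λ T → IsCopy Y Z T ×
    Σ (Subset k) λ C → ∣ C ∣ ≤ t ×
      (∀ S (p : IsCopy X Z S) → S ⊆ T → col α S p ∈ C)

-- Extensions of X in M^<_n.  A linear order on Fin (size X) is given by a
-- ranking bijection rank : Fin (size X) ↔ Fin (size X), with x < y iff
-- rank x < rank y.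
record Extension (n : ℕ) (X : Graph) : Set where
  field
    rank     : Fin (size X) ↔ Fin (size X)
    colour   : Fin (size X) → Fin n
    proper   : ProperColouring n X colour
    monotone : ∀ x y → Inverse.to rank x <ᶠ Inverse.to rank y → colour x ≤ᶠ colour y
open Extension public

Isomorphic : {n : ℕ} {X : Graph} → Extension n X → Extension n X → Set
Isomorphic {n} {X} e₁ e₂ = Σ (Fin (size X) ↔ Fin (size X)) λ f →
  let g = Inverse.to f in
  (∀ x y → E X x y ≡ E X (g x) (g y)) ×
  (∀ x y → (Inverse.to (rank e₁) x <ᶠ Inverse.to (rank e₁) y)
         ⇔ (Inverse.to (rank e₂) (g x) <ᶠ Inverse.to (rank e₂) (g y))) ×
  (∀ x → colour e₂ (g x) ≡ colour e₁ x)

-- τ(X) = t : there are exactly t isomorphism classes of extensions,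
-- witnessed by a system of representatives indexed by Fin t.
IsTau : (n : ℕ) (X : Graph) (t : ℕ) → Set
IsTau n X t = Σ (Fin t → Extension n X) λ rep →
  (∀ i j → Isomorphic (rep i) (rep j) → i ≡ j) ×
  (∀ e → ∃ λ i → Isomorphic e (rep i))

RamseyBound : (n : ℕ) (X : Graph) (t : ℕ) → Set
RamseyBound n X t = ∀ (Y : Graph) → Colourable n Y → ∀ (k : ℕ) →
  Σ Graph λ Z → Colourable n Z × Arrow Z Y X k t

RamseyDegree : (n : ℕ) (X : Graph) (t : ℕ) → Set
RamseyDegree n X t = RamseyBound n X t × (∀ t' → RamseyBound n X t' → t ≤ t')

{-# OPTIONS --safe #-}
-- A column of a graph G on an ordered vertex set is a letter: the empty set, a singleton or a
-- pair of vertices, and it has the elements of a pair only if that pair is an edge.  A word w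
-- that uses all letters sends a vertex y to the set of positions p with y in the letter w p;
-- two such sets meet exactly if the vertices are adjacent.  Together with the colour of y this
-- embeds an n-coloured G into one fixed n-coloured graph Z: the subsets of the positions, n
-- times, adjacent when they meet and have different colours.  Restricting letters along an
-- increasing embedding X → Y is a rigid surjection of letters, since the empty letter and the
-- singletons precede the pairs.  So the Graham-Rothschild dual Ramsey theorem (proved from
-- Hales-Jewett, which follows Shelah) gives one copy of Y on which the colour of a copy of X
-- depends only on the ordered coloured type of that copy, hence at most τ(X) colours.
--
-- Conversely let Y arise by applying this twice, for single points and for pairs of points in
-- one class, to a graph containing an n-clique and all types of X.  Then every colouring and
-- monotone ordering of Y is, on a suitable copy of that graph, the original one up to a
-- permutation of the colours and reversals inside classes, so every type of X occurs in Y,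
-- and colouring copies of X by their type needs τ(X) colours.
module Submission where

open import Defs
open import Data.Bool using (Bool; true; false; _∧_; _∨_; if_then_else_)
open import Data.Bool.Properties using (∨-identityʳ) renaming (_≟_ to _≟ᵇ_)
open import Data.Empty using (⊥; ⊥-elim)
open import Data.Fin using (Fin; zero; suc; toℕ; fromℕ<; opposite; combine; remQuot; splitAt; punchOut; _↑ˡ_; _↑ʳ_; funToFin; finToFun) renaming (_<_ to _<ᶠ_; _≤_ to _≤ᶠ_)
open import Data.Fin.Properties using (any?; all?; pigeonhole; suc-injective; punchOut-injective; toℕ<n; toℕ-injective; toℕ-fromℕ<; toℕ-combine; toℕ-↑ˡ; toℕ-↑ʳ; combine-monoˡ-<; combine-injectiveˡ; combine-injectiveʳ; remQuot-combine; combine-remQuot; splitAt-↑ˡ; splitAt-↑ʳ; splitAt⁻¹-↑ˡ; splitAt⁻¹-↑ʳ; opposite-prop; opposite-involutive; finToFun-funToFin; <⇒≢) renaming (_≟_ to _≟ᶠ_; _<?_ to _<ᶠ?_; _≤?_ to _≤ᶠ?_; <-cmp to <ᶠ-cmp; <-irrefl to <ᶠ-irrefl; <-asym to <ᶠ-asym; <-trans to <ᶠ-trans)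
open import Data.Fin.Subset using (Subset; _∈_; _⊆_; ∣_∣; ⊤; inside; outside) renaming (⊥ to ∅)
open import Data.Fin.Subset.Properties using (∣⊤∣≡n; ∣⊥∣≡0; ∈⊤; ⊆-antisym; p⊆q⇒∣p∣≤∣q∣; p⊂q⇒∣p∣<∣q∣)
open import Data.Maybe using (Maybe; just; nothing)
open import Data.Nat using (ℕ; zero; suc; _+_; _*_; _^_; _≤_; _<_; _≥_; z≤n; s≤s)
open import Data.Nat.Properties using (≤-refl; ≤-reflexive; ≤-trans; ≤-antisym; <⇒≤; ≤⇒≯; ≮⇒≥; n<1+n; n≤1+n; m≤m+n; m≤n⇒m≤1+n; m≤n⇒m<n∨m≡n; +-suc; +-identityʳ; +-monoʳ-<; ∸-monoʳ-<)
open import Data.Product using (Σ; ∃; _×_; _,_; proj₁; proj₂; uncurry)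
open import Data.Sum using (_⊎_; inj₁; inj₂; [_,_]′; map₂)
open import Data.Unit using (tt) renaming (⊤ to Unit)
open import Data.Vec using (Vec; []; _∷_; _++_; map; replicate; lookup; sum; tabulate; _[_]≔_)
open import Data.Vec.Properties using (lookup∘update; lookup∘update′; lookup-replicate; lookup∘tabulate; lookup⇒[]=; []=⇒lookup; []≔-updates; []≔-minimal)
open import Function using (_∘_; id)
open import Function.Bundles using (_↔_; Inverse; _⇔_; mk↔ₛ′; mk⇔; Equivalence)
open import Function.Construct.Identity using (↔-id)
open import Function.Definitions using (Injective)
open import Relation.Binary.Definitions using (tri<; tri≈; tri>)
open import Relation.Binary.PropositionalEquality using (_≡_; _≢_; refl; trans; cong; cong₂; subst; subst₂; _≗_) renaming (sym to ≡-sym)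
open import Relation.Nullary using (¬_; Dec; yes; no; does; ¬?; _×-dec_; _→-dec_)
open import Relation.Nullary.Decidable using (dec-true; map′)

-- The Hales-Jewett theorem

-- Colourings of a finite set V themselves serve as colours.
Encodable : Set → Set
Encodable V = ∀ k → Σ ℕ λ K → Σ ((V → Fin k) → Fin K) λ code →
  ∀ f g → code f ≡ code g → ∀ v → f v ≡ g v

encodable-Fin : ∀ n → Encodable (Fin n)
encodable-Fin n k = k ^ n , funToFin , λ f g eq v →
  trans (≡-sym (finToFun-funToFin f v)) (trans (cong (λ c → finToFun c v) eq) (finToFun-funToFin g v))

encodable-↠ : ∀ {V W : Set} (h : V → W) → (∀ w → ∃ λ v → h v ≡ w) → Encodable V → Encodable W
encodable-↠ h surj enc k with enc k
... | K , code , inj = K , (λ f → code (f ∘ h)) , λ f g eq w →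
  let v , hv≡w = surj w in subst (λ x → f x ≡ g x) hv≡w (inj (f ∘ h) (g ∘ h) eq v)

encodable-× : ∀ {V W : Set} → Encodable V → Encodable W → Encodable (V × W)
encodable-× encV encW k with encW k
... | K , codeW , injW with encV K
... | L , codeV , injV = L , (λ f → codeV λ v → codeW λ w → f (v , w)) , λ f g eq (v , w) →
  injW _ _ (injV _ _ eq v) w

encodable-⊎ : ∀ {V W : Set} → Encodable V → Encodable W → Encodable (V ⊎ W)
encodable-⊎ {V} {W} encV encW k with encV k | encW k
... | K , codeV , injV | L , codeW , injW =
  K * L , (λ f → combine (codeV (f ∘ inj₁)) (codeW (f ∘ inj₂))) , injective
  where
  injective : ∀ f g → combine (codeV (f ∘ inj₁)) (codeW (f ∘ inj₂)) ≡ combine (codeV (g ∘ inj₁)) (codeW (g ∘ inj₂)) →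
    ∀ v → f v ≡ g v
  injective f g eq (inj₁ v) = injV _ _ (combine-injectiveˡ (codeV (f ∘ inj₁)) (codeW (f ∘ inj₂)) (codeV (g ∘ inj₁)) _ eq) v
  injective f g eq (inj₂ w) = injW _ _ (combine-injectiveʳ (codeV (f ∘ inj₁)) (codeW (f ∘ inj₂)) (codeV (g ∘ inj₁)) _ eq) w

encodable-Vec : ∀ n M → Encodable (Vec (Fin n) M)
encodable-Vec n zero = encodable-↠ {V = Fin 1} (λ _ → []) (λ { [] → zero , refl }) (encodable-Fin 1)
encodable-Vec n (suc M) = encodable-↠ (λ (x , xs) → x ∷ xs) (λ { (x ∷ xs) → (x , xs) , refl })
  (encodable-× (encodable-Fin n) (encodable-Vec n M))

-- Combinatorial lines: letter zero is the variable, letter suc i is the constant i,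
-- and final marks the last occurrence of the variable.
data Line (n : ℕ) : ℕ → Set where
  final : ∀ {T} → Vec (Fin n) T → Line n (suc T)
  _∷_   : ∀ {T} → Fin (suc n) → Line n T → Line n (suc T)

letter : ∀ {n} → Fin (suc n) → Fin n → Fin n
letter zero    c = c
letter (suc i) c = i

point : ∀ {n T} → Line n T → Fin n → Vec (Fin n) T
point (final ws) c = c ∷ ws
point (a ∷ ℓ)    c = letter a c ∷ point ℓ c

-- A subspace of a special shape: the coordinates split into consecutive blocks, and each block
-- carries a line with a parameter of its own.
data Space (n : ℕ) : ℕ → ℕ → Set where
  []  : Space n 0 0
  _∷_ : ∀ {T D M} → Line n T → Space n D M → Space n (suc D) (T + M)

points : ∀ {n D M} → Space n D M → Vec (Fin n) D → Vec (Fin n) M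
points []      []       = []
points (ℓ ∷ S) (x ∷ xs) = point ℓ x ++ points S xs

_++ˡ_ : ∀ {n T M} → Line n T → Vec (Fin n) M → Line n (T + M)
final ws ++ˡ ys = final (ws ++ ys)
(a ∷ ℓ)  ++ˡ ys = a ∷ (ℓ ++ˡ ys)

point-++ˡ : ∀ {n T M} (ℓ : Line n T) (ys : Vec (Fin n) M) c → point (ℓ ++ˡ ys) c ≡ point ℓ c ++ ys
point-++ˡ (final ws) ys c = refl
point-++ˡ (a ∷ ℓ)    ys c = cong (letter a c ∷_) (point-++ˡ ℓ ys c)

prepend : ∀ {n T M} → Vec (Fin (suc n)) T → Line n M → Line n (T + M)
prepend []       ℓ = ℓ
prepend (a ∷ as) ℓ = a ∷ prepend as ℓ

point-prepend : ∀ {n T M} (as : Vec (Fin (suc n)) T) (ℓ : Line n M) c →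
  point (prepend as ℓ) c ≡ map (λ a → letter a c) as ++ point ℓ c
point-prepend []       ℓ c = refl
point-prepend (a ∷ as) ℓ c = cong (letter a c ∷_) (point-prepend as ℓ c)

-- The result is a word and not a line, because a constant `b` may leave no variable.
substitute : ∀ {n T} → Line n T → Fin (suc n) → Vec (Fin (suc n)) T
substitute (final ws) b       = b ∷ map suc ws
substitute (zero ∷ ℓ)  b      = b ∷ substitute ℓ b
substitute (suc i ∷ ℓ) b      = suc i ∷ substitute ℓ b

map-letter-suc : ∀ {n T} (ws : Vec (Fin n) T) c → map (λ a → letter a c) (map suc ws) ≡ ws
map-letter-suc []       c = refl
map-letter-suc (w ∷ ws) c = cong (w ∷_) (map-letter-suc ws c)

map-letter-substitute : ∀ {n T} (ℓ : Line n T) b c →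
  map (λ a → letter a c) (substitute ℓ b) ≡ point ℓ (letter b c)
map-letter-substitute (final ws)  b c = cong (letter b c ∷_) (map-letter-suc ws c)
map-letter-substitute (zero ∷ ℓ)  b c = cong (letter b c ∷_) (map-letter-substitute ℓ b c)
map-letter-substitute (suc i ∷ ℓ) b c = cong (i ∷_) (map-letter-substitute ℓ b c)

-- The block at the last occurrence of the variable is itself a line and supplies the last
-- occurrence in the composite. Earlier blocks need only be words with variables, and later blocks
-- are constant.
lineIn : ∀ {n D M} → Space n D M → Line n D → Line n M
lineIn (L ∷ S) (final ws) = L ++ˡ points S ws
lineIn (L ∷ S) (a ∷ ℓ)    = prepend (substitute L a) (lineIn S ℓ)

point-lineIn : ∀ {n D M} (S : Space n D M) (ℓ : Line n D) c → point (lineIn S ℓ) c ≡ points S (point ℓ c)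
point-lineIn (L ∷ S) (final ws) c = point-++ˡ L (points S ws) c
point-lineIn (L ∷ S) (a ∷ ℓ)    c = trans (point-prepend (substitute L a) (lineIn S ℓ) c)
  (cong₂ _++_ (map-letter-substitute L a c) (point-lineIn S ℓ c))

staircase : ∀ {n} T → Fin (suc T) → Vec (Fin (suc (suc n))) T
staircase T       zero    = replicate T (suc zero)
staircase (suc T) (suc i) = zero ∷ staircase T i

-- The two staircases differ exactly on the stretch between their steps; putting the variable there
-- gives the line.
staircase-line : ∀ {n} T (i j : Fin (suc T)) → i <ᶠ j → Σ (Line (suc (suc n)) T) λ ℓ →
  point ℓ zero ≡ staircase T j × point ℓ (suc zero) ≡ staircase T i
staircase-line zero    zero    zero    ()
staircase-line (suc T) zero    (suc zero)    _ = final (replicate T (suc zero)) , refl , refl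
staircase-line (suc (suc T)) zero    (suc (suc j)) _ =
  let ℓ , eqj , eqi = staircase-line (suc T) zero (suc j) (s≤s z≤n)
  in zero ∷ ℓ , cong (zero ∷_) eqj , cong (suc zero ∷_) eqi
staircase-line (suc T) (suc i) (suc j) (s≤s i<j) =
  let ℓ , eqj , eqi = staircase-line T i j i<j
  in suc zero ∷ ℓ , cong (zero ∷_) eqj , cong (zero ∷_) eqi

-- There are k + 1 staircases of length k, so two of them share a colour.
shelah-line : ∀ n k → Σ ℕ λ T → (χ : Vec (Fin (suc (suc n))) T → Fin k) →
  Σ (Line (suc (suc n)) T) λ ℓ → χ (point ℓ zero) ≡ χ (point ℓ (suc zero))
shelah-line n k = k , λ χ →
  let i , j , i<j , eq = pigeonhole (n<1+n k) (χ ∘ staircase k)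
      ℓ , eqj , eqi = staircase-line k i j i<j
  in ℓ , trans (cong χ eqj) (trans (≡-sym eq) (cong χ (≡-sym eqi)))

collapse : ∀ {n} → Fin (suc (suc n)) → Fin (suc (suc n))
collapse zero    = suc zero
collapse (suc i) = suc i

-- Shelah's insensitivity argument. The first block is chosen in size after the rest, since its line
-- must treat the letters zero and one alike for every continuation `y` at once. The rest is then
-- made insensitive simultaneously for all letters `d` of the first block.
insensitive-space : ∀ n D k → Σ ℕ λ M → (χ : Vec (Fin (suc (suc n))) M → Fin k) →
  Σ (Space (suc (suc n)) D M) λ S → ∀ x → χ (points S x) ≡ χ (points S (map collapse x))
insensitive-space n zero    k = 0 , λ χ → [] , λ { [] → refl }
insensitive-space n (suc D) k with encodable-Fin (suc (suc n)) k
... | K₁ , code₁ , inj₁′ with insensitive-space n D K₁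
... | M , space with encodable-Vec (suc (suc n)) M k
... | K₂ , code₂ , inj₂′ with shelah-line n K₂
... | T , line = T + M , λ χ →
  let ℓ , ℓ-eq = line (λ t → code₂ λ y → χ (t ++ y))
      S , S-eq = space (λ y → code₁ λ d → χ (point ℓ d ++ y))
      block-eq : ∀ d y → χ (point ℓ d ++ y) ≡ χ (point ℓ (collapse d) ++ y)
      block-eq = λ { zero y → inj₂′ _ _ ℓ-eq y ; (suc d) y → refl }
  in ℓ ∷ S , λ { (d ∷ x) → trans (inj₁′ _ _ (S-eq x) d) (block-eq d (points S (map collapse x))) }

-- The smaller alphabet becomes the set of letters other than zero, while the variable may now also
-- take the value zero.
embed : ∀ {n T} → Line (suc n) T → Line (suc (suc n)) T
embed (final ws)  = final (map suc ws)
embed (zero ∷ ℓ)  = zero ∷ embed ℓ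
embed (suc i ∷ ℓ) = suc (suc i) ∷ embed ℓ

point-embed : ∀ {n T} (ℓ : Line (suc n) T) c → point (embed ℓ) (suc c) ≡ map suc (point ℓ c)
point-embed (final ws)  c = refl
point-embed (zero ∷ ℓ)  c = cong (suc c ∷_) (point-embed ℓ c)
point-embed (suc i ∷ ℓ) c = cong (suc i ∷_) (point-embed ℓ c)

map-collapse-suc : ∀ {n T} (ws : Vec (Fin (suc n)) T) →
  map collapse (map suc ws) ≡ map suc ws
map-collapse-suc []       = refl
map-collapse-suc (w ∷ ws) = cong (suc w ∷_) (map-collapse-suc ws)

collapse-point-embed : ∀ {n T} (ℓ : Line (suc n) T) →
  map collapse (point (embed ℓ) zero) ≡ point (embed ℓ) (suc zero)
collapse-point-embed (final ws)  = cong (suc zero ∷_) (map-collapse-suc ws)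
collapse-point-embed (zero ∷ ℓ)  = cong (suc zero ∷_) (collapse-point-embed ℓ)
collapse-point-embed (suc i ∷ ℓ) = cong (suc i ∷_) (collapse-point-embed ℓ)

-- Induction on the alphabet. Inside an insensitive space, the smaller case gives a line that is
-- monochromatic on the letters other than zero. Its point at zero has the colour of its point at
-- one, because `collapse` carries the first to the second.
hales-jewett : ∀ n k → Σ ℕ λ T → (χ : Vec (Fin (suc n)) T → Fin k) →
  Σ (Line (suc n) T) λ ℓ → ∀ c d → χ (point ℓ c) ≡ χ (point ℓ d)
hales-jewett zero    k = 1 , λ χ → final [] , λ { zero zero → refl }
hales-jewett (suc n) k with hales-jewett n k
... | D , line with insensitive-space n D k
... | M , space = M , λ χ →
  let S , S-eq = space χ
      ℓ , ℓ-eq = line (λ x → χ (points S (map suc x)))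
      L = lineIn S (embed ℓ)
      small : ∀ c → χ (point L (suc c)) ≡ χ (points S (map suc (point ℓ c)))
      small c = cong χ (trans (point-lineIn S (embed ℓ) (suc c)) (cong (points S) (point-embed ℓ c)))
      constant : ∀ c → χ (point L c) ≡ χ (point L (suc zero))
      constant = λ { zero → trans (cong χ (point-lineIn S (embed ℓ) zero))
                       (trans (S-eq (point (embed ℓ) zero))
                         (trans (cong (χ ∘ points S) (collapse-point-embed ℓ))
                           (cong χ (≡-sym (point-lineIn S (embed ℓ) (suc zero))))))
                   ; (suc c) → trans (small c) (trans (ℓ-eq c zero) (≡-sym (small zero))) }
  in L , λ c d → trans (constant c) (≡-sym (constant d))

-- The dual Ramsey theorem

-- Surjective words of length N + 1 over m + 1 letters, the letters occurring first in order.
-- Positions and letters are both counted from the end: zero is the last position, and the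
-- letter whose first occurrence is the latest.
data Rigid : ℕ → ℕ → Set where
  one : Rigid 0 0
  new : ∀ {N m} → Rigid N m → Rigid (suc N) (suc m)
  old : ∀ {N m} → Rigid N m → Fin (suc m) → Rigid (suc N) m

_at_ : ∀ {N m} → Rigid N m → Fin (suc N) → Fin (suc m)
one     at zero  = zero
new w   at zero  = zero
new w   at suc p = suc (w at p)
old w a at zero  = a
old w a at suc p = w at p

at-surjective : ∀ {N m} (w : Rigid N m) a → ∃ λ p → w at p ≡ a
at-surjective one       zero    = zero , refl
at-surjective (new w)   zero    = zero , refl
at-surjective (new w)   (suc a) = let p , eq = at-surjective w a in suc p , cong suc eq
at-surjective (old w b) a       = let p , eq = at-surjective w a in suc p , eq

infixr 20 _⨟_
-- Composition of rigid surjections: a first occurrence in `w` calls up the next position of `u`,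
-- and a repetition in `w` repeats what `u` has at that letter.
_⨟_ : ∀ {N l m} → Rigid N l → Rigid l m → Rigid N m
one     ⨟ u       = u
new w   ⨟ new u   = new (w ⨟ u)
new w   ⨟ old u a = old (w ⨟ u) a
old w b ⨟ u       = old (w ⨟ u) (u at b)

⨟-at : ∀ {N l m} (w : Rigid N l) (u : Rigid l m) p → (w ⨟ u) at p ≡ u at (w at p)
⨟-at one       u         zero    = refl
⨟-at (new w)   (new u)   zero    = refl
⨟-at (new w)   (new u)   (suc p) = cong suc (⨟-at w u p)
⨟-at (new w)   (old u a) zero    = refl
⨟-at (new w)   (old u a) (suc p) = ⨟-at w u p
⨟-at (old w b) u         zero    = refl
⨟-at (old w b) u         (suc p) = ⨟-at w u p

⨟-assoc : ∀ {N k l m} (v : Rigid N k) (w : Rigid k l) (u : Rigid l m) → (v ⨟ w) ⨟ u ≡ v ⨟ w ⨟ u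
⨟-assoc one       w         u         = refl
⨟-assoc (new v)   (new w)   (new u)   = cong new (⨟-assoc v w u)
⨟-assoc (new v)   (new w)   (old u a) = cong (λ x → old x a) (⨟-assoc v w u)
⨟-assoc (new v)   (old w b) u         = cong (λ x → old x (u at b)) (⨟-assoc v w u)
⨟-assoc (old v c) w         u         = cong₂ old (⨟-assoc v w u) (≡-sym (⨟-at w u c))

encodable-Rigid : ∀ N m → Encodable (Rigid N m)
encodable-Rigid zero    zero    = encodable-↠ {V = Fin 1} (λ _ → one) (λ { one → zero , refl }) (encodable-Fin 1)
encodable-Rigid zero    (suc m) = encodable-↠ {V = Fin 0} (λ ()) (λ ()) (encodable-Fin 0)
encodable-Rigid (suc N) zero    =
  encodable-↠ {V = Rigid N zero} (λ w → old w zero) (λ { (old w zero) → w , refl }) (encodable-Rigid N zero)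
encodable-Rigid (suc N) (suc m) =
  encodable-↠ {V = Rigid N m ⊎ Rigid N (suc m) × Fin (suc (suc m))}
    (λ { (inj₁ w) → new w ; (inj₂ (w , a)) → old w a })
    (λ { (new w) → inj₁ w , refl ; (old w a) → inj₂ (w , a) , refl })
    (encodable-⊎ (encodable-Rigid N m) (encodable-× (encodable-Rigid N (suc m)) (encodable-Fin (suc (suc m)))))

zeros : ∀ N → Rigid N 0
zeros zero    = one
zeros (suc N) = old (zeros N) zero

zeros-unique : ∀ {N} (w : Rigid N 0) → w ≡ zeros N
zeros-unique one          = refl
zeros-unique (old w zero) = cong (λ x → old x zero) (zeros-unique w)

identity : ∀ N → Rigid N N
identity zero    = one
identity (suc N) = new (identity N)

identity-⨟ : ∀ {N m} (w : Rigid N m) → identity N ⨟ w ≡ w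
identity-⨟ one       = refl
identity-⨟ (new w)   = cong new (identity-⨟ w)
identity-⨟ (old w a) = cong (λ x → old x a) (identity-⨟ w)

truncation : ∀ {N m} → m ≤ N → Rigid N m
truncation z≤n       = zeros _
truncation (s≤s m≤N) = new (truncation m≤N)

appendWord : ∀ {N m T} → Vec (Fin (suc m)) T → Rigid N m → Rigid (T + N) m
appendWord []       w = w
appendWord (a ∷ as) w = old (appendWord as w) a

-- The variable becomes a new letter behind the identity word. Words are built from the end, so what
-- `final` marks as the last occurrence of the variable is the first occurrence of that letter. Both
-- conventions call it zero, so the letters need no translation.
appendLine : ∀ {N T} → Line (suc N) T → Rigid (T + N) (suc N)
appendLine (final as) = new (appendWord as (identity _))
appendLine (a ∷ ℓ)    = old (appendLine ℓ) a

appendWord-⨟ : ∀ {N m l T} (as : Vec (Fin (suc m)) T) (w : Rigid N m) (u : Rigid m l) →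
  appendWord as w ⨟ u ≡ appendWord (map (u at_) as) (w ⨟ u)
appendWord-⨟ []       w u = refl
appendWord-⨟ (a ∷ as) w u = cong (λ x → old x (u at a)) (appendWord-⨟ as w u)

at-letter : ∀ {N m} (u : Rigid N m) a c → old u (u at c) at a ≡ u at letter a c
at-letter u zero    c = refl
at-letter u (suc a) c = refl

appendLine-⨟ : ∀ {N m T} (ℓ : Line (suc N) T) (u : Rigid N m) c →
  appendLine ℓ ⨟ old u (u at c) ≡ appendWord (map (u at_) (point ℓ c)) u
appendLine-⨟ (final as) u c = cong (λ x → old x (u at c))
  (trans (appendWord-⨟ as (identity _) u) (cong (appendWord (map (u at_) as)) (identity-⨟ u)))
appendLine-⨟ (a ∷ ℓ)    u c = cong₂ old (appendLine-⨟ ℓ u c) (at-letter u a c)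

-- Hales-Jewett with the positions of `u` as alphabet: a word `t` of positions is coloured by the
-- colours, for all `u` at once, of `u` prolonged by its own letters at these positions. As `u` is
-- surjective, every `a` is `u at c` for some `c`, and `old u a` then corresponds to the point of
-- the line at `c`.
last-letter-irrelevant : ∀ N m k → Σ ℕ λ M → (χ : Rigid M m → Fin k) →
  Σ (Rigid M (suc N)) λ w → ∀ (u : Rigid N m) a b → χ (w ⨟ old u a) ≡ χ (w ⨟ old u b)
last-letter-irrelevant N m k with encodable-Rigid N m k
... | K , code , inj with hales-jewett N K
... | T , line = T + N , λ χ →
  let ℓ , ℓ-eq = line (λ t → code λ u → χ (appendWord (map (u at_) t) u))
      constant : ∀ u a b → χ (appendLine ℓ ⨟ old u a) ≡ χ (appendLine ℓ ⨟ old u b)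
      constant u a b = let c , c-eq = at-surjective u a
                           d , d-eq = at-surjective u b in
        subst (λ a → χ (appendLine ℓ ⨟ old u a) ≡ χ (appendLine ℓ ⨟ old u b)) c-eq
          (subst (λ b → χ (appendLine ℓ ⨟ old u (u at c)) ≡ χ (appendLine ℓ ⨟ old u b)) d-eq
            (trans (cong χ (appendLine-⨟ ℓ u c))
              (trans (inj _ _ (ℓ-eq c d) u) (cong χ (≡-sym (appendLine-⨟ ℓ u d))))))
  in appendLine ℓ , constant

-- The position at which the last letter makes its first occurrence.
birth : ∀ {N m} → Rigid N (suc m) → Fin N
birth (new w)   = zero
birth (old w a) = suc (birth w)

DualRamsey : ℕ → Set
DualRamsey m = ∀ l k → Σ ℕ λ N → (χ : Rigid N m → Fin (suc k)) →
  Σ (Rigid N l) λ w → Σ (Fin (suc k)) λ c → ∀ u → χ (w ⨟ u) ≡ c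

-- Words old u a are handled by Hales-Jewett, which makes a irrelevant, and by recursion on u;
-- words new u by the dual Ramsey theorem with one letter less.
birth-colouring : ∀ {m} → DualRamsey m → ∀ l k → Σ ℕ λ N → (χ : Rigid N (suc m) → Fin (suc k)) →
  Σ (Rigid N l) λ w → Σ (Vec (Fin (suc k)) l) λ γ → ∀ u → χ (w ⨟ u) ≡ lookup γ (birth u)
birth-colouring DR zero    k = 0 , λ χ → one , [] , λ ()
birth-colouring {m} DR (suc l) k with birth-colouring DR l k
... | N₁ , births with DR N₁ k
... | N₂ , ramsey with last-letter-irrelevant N₂ (suc m) (suc k)
... | N₃ , tails = N₃ , λ χ →
  let w₀ , w₀-eq = tails χ
      w₁ , c , w₁-eq = ramsey (λ u → χ (w₀ ⨟ new u))
      w₂ , γ , w₂-eq = births (λ u → χ (w₀ ⨟ old (w₁ ⨟ u) zero))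
      w = w₀ ⨟ new (w₁ ⨟ w₂)
      -- A word `new u` has birth zero and gets the colour `c` from `w₁`; in `old u a` the birth of
      -- `u` is shifted by one, so its colour is read from γ.
      constant : ∀ u → χ (w ⨟ u) ≡ lookup (c ∷ γ) (birth u)
      constant = λ
        { (new u) → trans (cong χ (trans (⨟-assoc w₀ (new (w₁ ⨟ w₂)) (new u))
            (cong (λ x → w₀ ⨟ new x) (⨟-assoc w₁ w₂ u)))) (w₁-eq (w₂ ⨟ u))
        ; (old u a) → trans (cong χ (trans (⨟-assoc w₀ (new (w₁ ⨟ w₂)) (old u a))
            (cong (λ x → w₀ ⨟ old x a) (⨟-assoc w₁ w₂ u)))) (trans (w₀-eq (w₁ ⨟ w₂ ⨟ u) a zero) (w₂-eq u)) }
  in w , c ∷ γ , constant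

occurrences : ∀ {k L} → Fin k → Vec (Fin k) L → ℕ
occurrences c []      = 0
occurrences c (d ∷ γ) with d ≟ᶠ c
... | yes _ = suc (occurrences c γ)
... | no  _ = occurrences c γ

-- A new letter starts at each position coloured `c` and the latest letter is repeated elsewhere.
-- Hence, after any further identification of letters, births still happen only at positions
-- coloured `c`.
select : ∀ {k L} c (γ : Vec (Fin k) L) → Rigid L (occurrences c γ)
select c []      = one
select c (d ∷ γ) with d ≟ᶠ c
... | yes _ = new (select c γ)
... | no  _ = old (select c γ) zero

select-birth : ∀ {k L m} c (γ : Vec (Fin k) L) (u : Rigid (occurrences c γ) (suc m)) →
  lookup γ (birth (select c γ ⨟ u)) ≡ c
select-birth c (d ∷ γ) u with d ≟ᶠ c
select-birth c (d ∷ γ) (new u)   | yes d≡c = d≡c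
select-birth c (d ∷ γ) (old u a) | yes d≡c = select-birth c γ u
select-birth c (d ∷ γ) u         | no  d≢c = select-birth c γ u

sum-decrement : ∀ {k} (b : Vec ℕ k) c {x} → lookup b c ≡ suc x → sum b ≡ suc (sum (b [ c ]≔ x))
sum-decrement (y ∷ b) zero    refl = refl
sum-decrement (y ∷ b) (suc c) eq   = trans (cong (y +_) (sum-decrement b c eq)) (+-suc y _)

-- Each entry of γ spends one unit of the quota of its colour. There are more entries than units, so
-- some colour overdraws its quota.
budget-pigeonhole : ∀ {k L} (b : Vec ℕ k) (γ : Vec (Fin k) L) → sum b < L → ∃ λ c → lookup b c < occurrences c γ
budget-pigeonhole b (d ∷ γ) (s≤s sum≤) with lookup b d in eq
budget-pigeonhole b (d ∷ γ) (s≤s sum≤) | zero = d , lemma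
  where
  lemma : lookup b d < occurrences d (d ∷ γ)
  lemma rewrite eq with d ≟ᶠ d
  ... | yes _   = s≤s z≤n
  ... | no  d≢d = ⊥-elim (d≢d refl)
budget-pigeonhole b (d ∷ γ) (s≤s sum≤) | suc x
  with budget-pigeonhole (b [ d ]≔ x) γ (subst (_≤ _) (sum-decrement b d eq) sum≤)
... | c , occ = c , lemma
  where
  lemma : lookup b c < occurrences c (d ∷ γ)
  lemma with d ≟ᶠ c
  ... | yes refl rewrite eq = s≤s (subst (_< _) (lookup∘update d b x) occ)
  ... | no  d≢c  = subst (_< _) (lookup∘update′ (d≢c ∘ ≡-sym) b x) occ

frequent-colour : ∀ k l → Σ ℕ λ L → (γ : Vec (Fin k) L) → ∃ λ c → l ≤ occurrences c γ
frequent-colour k l = suc (sum (replicate k l)) , λ γ →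
  let c , occ = budget-pigeonhole (replicate k l) γ ≤-refl
  in c , ≤-trans (m≤n⇒m≤1+n (subst (l ≤_) (≡-sym (lookup-replicate c l)) ≤-refl)) occ

abstract
  -- Induction on the number of letters. `birth-colouring` reduces the colour of a word to the
  -- colour γ of the place where the last letter is born, and a frequent colour of γ makes it
  -- constant.
  dual-ramsey : ∀ m → DualRamsey m
  dual-ramsey zero    l k = l , λ χ → identity l , χ (identity l ⨟ zeros l) , λ u →
    cong (λ v → χ (identity l ⨟ v)) (zeros-unique u)
  dual-ramsey (suc m) l k with frequent-colour (suc k) l
  ... | L , frequent with birth-colouring (dual-ramsey m) L k
  ... | N , births = N , λ χ →
    let w , γ , w-eq = births χ
        c , l≤ = frequent γ
        v = select c γ
        -- The colour may occur more than `l` times; identifying the earliest letters leaves the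
        -- right number.
        t = truncation l≤
    in w ⨟ v ⨟ t , c , λ u →
      trans (cong χ (trans (⨟-assoc w (v ⨟ t) u) (cong (w ⨟_) (⨟-assoc v t u))))
        (trans (w-eq (v ⨟ t ⨟ u)) (select-birth c γ (t ⨟ u)))

-- Letters and their restrictions

≢zero⇒suc : ∀ {m} (x : Fin (suc m)) → x ≢ zero → ∃ λ y → x ≡ suc y
≢zero⇒suc zero    x≢0 = ⊥-elim (x≢0 refl)
≢zero⇒suc (suc y) x≢0 = y , refl

-- The section s picks the first occurrence of each letter; positions count from the end,
-- so it is the largest preimage.
rigidify : ∀ {N m} (g : Fin (suc N) → Fin (suc m)) (s : Fin (suc m) → Fin (suc N)) →
  (∀ a b → a <ᶠ b → s a <ᶠ s b) → (∀ a → g (s a) ≡ a) → (∀ p → p ≤ᶠ s (g p)) →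
  Σ (Rigid N m) λ w → ∀ p → w at p ≡ g p
rigidify {zero} {zero}  g s mono ret bound = one , λ { zero → fin1 (g zero) }
  where
  fin1 : (x : Fin 1) → zero ≡ x
  fin1 zero = refl
rigidify {zero} {suc m} g s mono ret bound with s zero | s (suc zero) | mono zero (suc zero) (s≤s z≤n)
... | zero | zero | ()
-- The last letter is born at `s zero`, so the word ends in `new` exactly if that is the last
-- position. With a single letter this cannot happen, as `bound` puts the birth at the very first
-- position.
rigidify {suc N} {m} g s mono ret bound with s zero in s0
rigidify {suc N} {zero} g s mono ret bound | zero with g (suc zero) | bound (suc zero)
... | zero | 1≤s0 with subst (λ x → 1 ≤ toℕ x) s0 1≤s0
... | ()
rigidify {suc N} {suc m} g s mono ret bound | zero =
  let w , w-at = rigidify g′ s′ mono′ ret′ bound′ in new w , λ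
    { zero → ≡-sym (trans (cong g (≡-sym s0)) (ret zero))
    ; (suc p) → trans (cong suc (w-at p)) (≡-sym (g-eq p)) }
  where
  g-suc : ∀ p → ∃ λ b → g (suc p) ≡ suc b
  g-suc p = ≢zero⇒suc (g (suc p)) λ eq →
    absurd (subst (λ x → suc p ≤ᶠ x) s0 (subst (λ x → suc p ≤ᶠ s x) eq (bound (suc p))))
    where
    absurd : ¬ (suc p ≤ᶠ zero {suc N})
    absurd ()
  g′ = proj₁ ∘ g-suc
  g-eq = proj₂ ∘ g-suc
  s-suc : ∀ a → ∃ λ b → s (suc a) ≡ suc b
  s-suc a = ≢zero⇒suc (s (suc a)) λ eq → absurd (subst (s zero <ᶠ_) eq (mono zero (suc a) (s≤s z≤n)))
    where
    absurd : ¬ (s zero <ᶠ zero {suc N})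
    absurd ()
  s′ = proj₁ ∘ s-suc
  s-eq = proj₂ ∘ s-suc
  mono′ : ∀ a b → a <ᶠ b → s′ a <ᶠ s′ b
  mono′ a b a<b with subst₂ _<ᶠ_ (s-eq a) (s-eq b) (mono (suc a) (suc b) (s≤s a<b))
  ... | s≤s lt = lt
  ret′ : ∀ a → g′ (s′ a) ≡ a
  ret′ a with trans (≡-sym (g-eq (s′ a))) (trans (cong g (≡-sym (s-eq a))) (ret (suc a)))
  ... | eq = suc-injective eq
  bound′ : ∀ p → p ≤ᶠ s′ (g′ p)
  bound′ p with subst (suc p ≤ᶠ_) (trans (cong s (g-eq p)) (s-eq (g′ p))) (bound (suc p))
  ... | s≤s le = le
rigidify {suc N} {m} g s mono ret bound | suc q =
  let w , w-at = rigidify (g ∘ suc) s′ mono′ ret′ bound′ in old w (g zero) , λ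
    { zero → refl ; (suc p) → w-at p }
  where
  s-suc : ∀ a → ∃ λ b → s a ≡ suc b
  s-suc zero    = q , s0
  s-suc (suc a) = ≢zero⇒suc (s (suc a)) λ eq → absurd (subst (s zero <ᶠ_) eq (mono zero (suc a) (s≤s z≤n)))
    where
    absurd : ¬ (s zero <ᶠ zero {suc N})
    absurd ()
  s′ = proj₁ ∘ s-suc
  s-eq = proj₂ ∘ s-suc
  mono′ : ∀ a b → a <ᶠ b → s′ a <ᶠ s′ b
  mono′ a b a<b with subst₂ _<ᶠ_ (s-eq a) (s-eq b) (mono a b a<b)
  ... | s≤s lt = lt
  ret′ : ∀ a → g (suc (s′ a)) ≡ a
  ret′ a = trans (cong g (≡-sym (s-eq a))) (ret a)
  bound′ : ∀ p → p ≤ᶠ s′ (g (suc p))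
  bound′ p with subst (suc p ≤ᶠ_) (s-eq (g (suc p))) (bound (suc p))
  ... | s≤s le = le

-- All ordered pairs are letters, edges or not, so the number of letters depends on `s` only and one
-- word can serve several graphs of the same size.
data Letter (s : ℕ) : Set where
  empty  : Letter s
  single : Fin s → Letter s
  pair   : Fin s → Fin s → Letter s

-- Restriction may lose elements of a letter, so the kinds with fewer vertices come first. Within a
-- kind the order is lexicographic, which increasing maps preserve.
data _≺_ {s : ℕ} : Letter s → Letter s → Set where
  empty≺single  : ∀ {x} → empty ≺ single x
  empty≺pair    : ∀ {x y} → empty ≺ pair x y
  single≺single : ∀ {x y} → x <ᶠ y → single x ≺ single y
  single≺pair   : ∀ {x y z} → single x ≺ pair y z
  pair≺pairˡ    : ∀ {x x′ y y′} → x <ᶠ x′ → pair x y ≺ pair x′ y′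
  pair≺pairʳ    : ∀ {x y y′} → y <ᶠ y′ → pair x y ≺ pair x y′

≺-total : ∀ {s} (a b : Letter s) → a ≺ b ⊎ a ≡ b ⊎ b ≺ a
≺-total empty      empty      = inj₂ (inj₁ refl)
≺-total empty      (single x) = inj₁ empty≺single
≺-total empty      (pair x y) = inj₁ empty≺pair
≺-total (single x) empty      = inj₂ (inj₂ empty≺single)
≺-total (single x) (single y) with <ᶠ-cmp x y
... | tri< x<y _ _  = inj₁ (single≺single x<y)
... | tri≈ _ refl _ = inj₂ (inj₁ refl)
... | tri> _ _ y<x  = inj₂ (inj₂ (single≺single y<x))
≺-total (single x) (pair y z) = inj₁ single≺pair
≺-total (pair x y) empty      = inj₂ (inj₂ empty≺pair)
≺-total (pair x y) (single z) = inj₂ (inj₂ single≺pair)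
≺-total (pair x y) (pair x′ y′) with <ᶠ-cmp x x′
... | tri< x<x′ _ _ = inj₁ (pair≺pairˡ x<x′)
... | tri> _ _ x′<x = inj₂ (inj₂ (pair≺pairˡ x′<x))
... | tri≈ _ refl _ with <ᶠ-cmp y y′
... | tri< y<y′ _ _ = inj₁ (pair≺pairʳ y<y′)
... | tri> _ _ y′<y = inj₂ (inj₂ (pair≺pairʳ y′<y))
... | tri≈ _ refl _ = inj₂ (inj₁ refl)

index : ∀ {s} → Letter s → Fin (suc (s + s * s))
index {s} empty      = zero
index {s} (single x) = suc (x ↑ˡ s * s)
index {s} (pair x y) = suc (s ↑ʳ combine x y)

unindex : ∀ {s} → Fin (suc (s + s * s)) → Letter s
unindex     zero    = empty
unindex {s} (suc i) = [ single , uncurry pair ∘ remQuot s ]′ (splitAt s i)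

unindex-index : ∀ {s} (a : Letter s) → unindex (index a) ≡ a
unindex-index     empty      = refl
unindex-index {s} (single x) rewrite splitAt-↑ˡ s x (s * s) = refl
unindex-index {s} (pair x y) rewrite splitAt-↑ʳ s (s * s) (combine x y) = cong (uncurry pair) (remQuot-combine x y)

index-unindex : ∀ {s} (i : Fin (suc (s + s * s))) → index (unindex {s} i) ≡ i
index-unindex     zero    = refl
index-unindex {s} (suc i) with splitAt s i in eq
... | inj₁ x = cong suc (splitAt⁻¹-↑ˡ eq)
... | inj₂ y = cong suc (trans (cong (s ↑ʳ_) (combine-remQuot {s} s y)) (splitAt⁻¹-↑ʳ eq))

combine-monoʳ-< : ∀ {m n} (i : Fin m) {j k : Fin n} → j <ᶠ k → combine i j <ᶠ combine i k
combine-monoʳ-< {n = n} i {j} {k} j<k =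
  subst₂ _<_ (≡-sym (toℕ-combine i j)) (≡-sym (toℕ-combine i k)) (+-monoʳ-< (n * toℕ i) j<k)

index-mono : ∀ {s} {a b : Letter s} → a ≺ b → index a <ᶠ index b
index-mono empty≺single = s≤s z≤n
index-mono empty≺pair   = s≤s z≤n
index-mono {s} (single≺single {x} {y} x<y) =
  s≤s (subst₂ _<_ (≡-sym (toℕ-↑ˡ x (s * s))) (≡-sym (toℕ-↑ˡ y (s * s))) x<y)
index-mono {s} (single≺pair {x} {y} {z}) =
  s≤s (subst₂ _<_ (≡-sym (toℕ-↑ˡ x (s * s))) (≡-sym (toℕ-↑ʳ s (combine y z))) (≤-trans (toℕ<n x) (m≤m+n s _)))
index-mono {s} (pair≺pairˡ {x} {x′} {y} {y′} x<x′) =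
  s≤s (subst₂ _<_ (≡-sym (toℕ-↑ʳ s (combine x y))) (≡-sym (toℕ-↑ʳ s (combine x′ y′)))
    (+-monoʳ-< s (combine-monoˡ-< y y′ x<x′)))
index-mono {s} (pair≺pairʳ {x} {y} {y′} y<y′) =
  s≤s (subst₂ _<_ (≡-sym (toℕ-↑ʳ s (combine x y))) (≡-sym (toℕ-↑ʳ s (combine x y′)))
    (+-monoʳ-< s (combine-monoʳ-< x y<y′)))

opposite-anti : ∀ {n} {i j : Fin n} → i <ᶠ j → opposite j <ᶠ opposite i
opposite-anti {n} {i} {j} i<j =
  subst₂ _<_ (≡-sym (opposite-prop j)) (≡-sym (opposite-prop i)) (∸-monoʳ-< (s≤s i<j) (toℕ<n j))

-- Reversed, as the letters of rigid words are counted from the end.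
code : ∀ {s} → Letter s → Fin (suc (s + s * s))
code a = opposite (index a)

decode : ∀ {s} → Fin (suc (s + s * s)) → Letter s
decode i = unindex (opposite i)

decode-code : ∀ {s} (a : Letter s) → decode (code a) ≡ a
decode-code a = trans (cong unindex (opposite-involutive (index a))) (unindex-index a)

code-decode : ∀ {s} (i : Fin (suc (s + s * s))) → code (decode {s} i) ≡ i
code-decode {s} i = trans (cong opposite (index-unindex {s} (opposite i))) (opposite-involutive i)

code-anti : ∀ {s} {a b : Letter s} → a ≺ b → code b <ᶠ code a
code-anti a≺b = opposite-anti (index-mono a≺b)

decode-anti : ∀ {s} {i j : Fin (suc (s + s * s))} → i <ᶠ j → decode {s} j ≺ decode i
decode-anti {s} {i} {j} i<j with ≺-total (decode {s} j) (decode i)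
... | inj₁ j≺i        = j≺i
... | inj₂ (inj₁ j≡i) =
  ⊥-elim (<ᶠ-irrefl (trans (≡-sym (code-decode {s} i)) (trans (cong code (≡-sym j≡i)) (code-decode {s} j))) i<j)
... | inj₂ (inj₂ i≺j) =
  ⊥-elim (<ᶠ-asym i<j (subst₂ _<ᶠ_ (code-decode {s} j) (code-decode {s} i) (code-anti i≺j)))

-- Vertices are ordered as the elements of Fin s.
record Partite (n s : ℕ) : Set where
  field
    adj      : Fin s → Fin s → Bool
    adj-sym  : ∀ x y → adj x y ≡ adj y x
    part     : Fin s → Fin n
    adj-part : ∀ x y → adj x y ≡ true → part x ≢ part y
open Partite

≢true⇒false : ∀ {b} → b ≢ true → b ≡ false
≢true⇒false {true}  b≢t = ⊥-elim (b≢t refl)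
≢true⇒false {false} b≢t = refl

bool-ext : ∀ {a b} → (a ≡ true → b ≡ true) → (b ≡ true → a ≡ true) → a ≡ b
bool-ext {true}  {b}     f g = ≡-sym (f refl)
bool-ext {false} {true}  f g = g refl
bool-ext {false} {false} f g = refl

graph : ∀ {n s} → Partite n s → Graph
graph {n} {s} A = record
  { size = s ; E = adj A ; sym = adj-sym A ; irrefl = λ x → ≢true⇒false λ e → adj-part A x x e refl }

record Monotone {n s r : ℕ} (A : Partite n s) (B : Partite n r) (f : Fin s → Fin r) : Set where
  field
    increasing : ∀ x y → x <ᶠ y → f x <ᶠ f y
    adj-pres   : ∀ x y → adj A x y ≡ adj B (f x) (f y)
    part-pres  : ∀ x → part A x ≡ part B (f x)
open Monotone

increasing⇒injective : ∀ {s r} {f : Fin s → Fin r} → (∀ x y → x <ᶠ y → f x <ᶠ f y) → ∀ {x y} → f x ≡ f y → x ≡ y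
increasing⇒injective inc {x} {y} eq with <ᶠ-cmp x y
... | tri< x<y _ _ = ⊥-elim (<ᶠ-irrefl eq (inc x y x<y))
... | tri≈ _ x≡y _ = x≡y
... | tri> _ _ y<x = ⊥-elim (<ᶠ-irrefl (≡-sym eq) (inc y x y<x))

contains : ∀ {n s} → Partite n s → Letter s → Fin s → Bool
contains A empty      z = false
contains A (single x) z = does (x ≟ᶠ z)
contains A (pair x y) z = adj A x y ∧ (does (x ≟ᶠ z) ∨ does (y ≟ᶠ z))

preimage? : ∀ {s r} (f : Fin s → Fin r) y → Dec (∃ λ x → f x ≡ y)
preimage? f y = any? (λ x → f x ≟ᶠ y)

mapLetter : ∀ {s r} → (Fin s → Fin r) → Letter s → Letter r
mapLetter f empty      = empty
mapLetter f (single x) = single (f x)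
mapLetter f (pair x y) = pair (f x) (f y)

mapLetter-mono : ∀ {s r} {f : Fin s → Fin r} → (∀ x y → x <ᶠ y → f x <ᶠ f y) →
  ∀ {a b} → a ≺ b → mapLetter f a ≺ mapLetter f b
mapLetter-mono inc empty≺single        = empty≺single
mapLetter-mono inc empty≺pair          = empty≺pair
mapLetter-mono inc (single≺single x<y) = single≺single (inc _ _ x<y)
mapLetter-mono inc single≺pair         = single≺pair
mapLetter-mono inc (pair≺pairˡ x<y)    = pair≺pairˡ (inc _ _ x<y)
mapLetter-mono inc (pair≺pairʳ x<y)    = pair≺pairʳ (inc _ _ x<y)

-- The trace of a letter on the range of `f`. A pair inside the range stays a pair even if it is no
-- edge, so that `mapLetter f` is a section. A pair with one end outside is replaced by what remains
-- of its elements.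
restrict : ∀ {n s r} → Partite n r → (Fin s → Fin r) → Letter r → Letter s
restrict B f empty = empty
restrict B f (single y) with preimage? f y
... | yes (x , _) = single x
... | no _        = empty
restrict B f (pair y y′) with preimage? f y | preimage? f y′ | adj B y y′
... | yes (x , _) | yes (x′ , _) | _     = pair x x′
... | yes (x , _) | no _         | true  = single x
... | no _        | yes (x′ , _) | true  = single x′
... | yes _       | no _         | false = empty
... | no _        | yes _        | false = empty
... | no _        | no _         | _     = empty

restrict-mapLetter : ∀ {n s r} (B : Partite n r) {f : Fin s → Fin r} → (∀ {x y} → f x ≡ f y → x ≡ y) →
  ∀ a → restrict B f (mapLetter f a) ≡ a
restrict-mapLetter B inj empty = refl
restrict-mapLetter B {f} inj (single x) with preimage? f (f x)
... | yes (_ , eq) = cong single (inj eq)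
... | no ¬p        = ⊥-elim (¬p (x , refl))
restrict-mapLetter B {f} inj (pair x y) with preimage? f (f x) | preimage? f (f y)
... | yes (_ , eq) | yes (_ , eq′) = cong₂ pair (inj eq) (inj eq′)
... | no ¬p        | _             = ⊥-elim (¬p (x , refl))
... | yes _        | no ¬p         = ⊥-elim (¬p (y , refl))

-- The lift of a restricted letter is thus the first letter with that restriction. As `code`
-- reverses the order, this is the last hypothesis of `rigidify`.
mapLetter-restrict : ∀ {n s r} (B : Partite n r) (f : Fin s → Fin r) a →
  mapLetter f (restrict B f a) ≺ a ⊎ mapLetter f (restrict B f a) ≡ a
mapLetter-restrict B f empty = inj₂ refl
mapLetter-restrict B f (single y) with preimage? f y
... | yes (x , eq) = inj₂ (cong single eq)
... | no _         = inj₁ empty≺single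
mapLetter-restrict B f (pair y y′) with preimage? f y | preimage? f y′ | adj B y y′
... | yes (x , eq) | yes (x′ , eq′) | _     = inj₂ (cong₂ pair eq eq′)
... | yes _        | no _           | true  = inj₁ single≺pair
... | no _         | yes _          | true  = inj₁ single≺pair
... | yes _        | no _           | false = inj₁ empty≺pair
... | no _         | yes _          | false = inj₁ empty≺pair
... | no _         | no _           | _     = inj₁ empty≺pair

does-≟-injective : ∀ {s r} {f : Fin s → Fin r} → (∀ {x y} → f x ≡ f y → x ≡ y) →
  ∀ {x y z} → f x ≡ y → does (x ≟ᶠ z) ≡ does (y ≟ᶠ f z)
does-≟-injective {f = f} inj {x} {_} {z} refl with x ≟ᶠ z | f x ≟ᶠ f z
... | yes _    | yes _  = refl
... | no _     | no _   = refl
... | yes refl | no ≢   = ⊥-elim (≢ refl)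
... | no ≢     | yes eq = ⊥-elim (≢ (inj eq))

does-≟-outside : ∀ {s r} {f : Fin s → Fin r} {y} → ¬ (∃ λ x → f x ≡ y) → ∀ {z} → false ≡ does (y ≟ᶠ f z)
does-≟-outside {f = f} {y} ¬p {z} with y ≟ᶠ f z
... | yes eq = ⊥-elim (¬p (z , ≡-sym eq))
... | no _   = refl

contains-restrict : ∀ {n s r} {A : Partite n s} {B : Partite n r} {f} → Monotone A B f →
  ∀ a z → contains A (restrict B f a) z ≡ contains B a (f z)
contains-restrict mono empty z = refl
contains-restrict {f = f} mono (single y) z with preimage? f y
... | yes (x , eq) = does-≟-injective (increasing⇒injective (increasing mono)) eq
... | no ¬p        = does-≟-outside ¬p
contains-restrict {A = A} {B} {f} mono (pair y y′) z with preimage? f y | preimage? f y′ | adj B y y′ in adj-eq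
... | yes (x , eq) | yes (x′ , eq′) | b = cong₂ _∧_ (trans (adj-pres mono x x′) (trans (cong₂ (adj B) eq eq′) adj-eq))
  (cong₂ _∨_ (does-≟-injective inj eq) (does-≟-injective inj eq′))
  where inj = increasing⇒injective (increasing mono)
... | yes (x , eq) | no ¬p′ | true rewrite ≡-sym (does-≟-outside ¬p′ {z}) =
  trans (does-≟-injective (increasing⇒injective (increasing mono)) eq) (≡-sym (∨-identityʳ _))
... | no ¬p | yes (x′ , eq′) | true rewrite ≡-sym (does-≟-outside ¬p {z}) =
  does-≟-injective (increasing⇒injective (increasing mono)) eq′
... | no ¬p | no ¬p′ | true rewrite ≡-sym (does-≟-outside ¬p {z}) = does-≟-outside ¬p′
... | yes _ | no _   | false = refl
... | no _  | yes _  | false = refl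
... | no _  | no _   | false = refl

restriction : ∀ {n s r} {A : Partite n s} {B : Partite n r} {f} → Monotone A B f →
  Σ (Rigid (r + r * r) (s + s * s)) λ u → ∀ p → u at p ≡ code (restrict B f (decode p))
restriction {n} {s} {r} {A} {B} {f} mono = rigidify g section section-mono retract bound
  where
  g : Fin (suc (r + r * r)) → Fin (suc (s + s * s))
  g p = code (restrict B f (decode p))
  section : Fin (suc (s + s * s)) → Fin (suc (r + r * r))
  section a = code (mapLetter f (decode a))
  section-mono : ∀ a b → a <ᶠ b → section a <ᶠ section b
  section-mono a b a<b = code-anti (mapLetter-mono (increasing mono) (decode-anti a<b))
  retract : ∀ a → g (section a) ≡ a
  retract a = trans (cong (code ∘ restrict B f) (decode-code (mapLetter f (decode a))))
    (trans (cong code (restrict-mapLetter B (increasing⇒injective (increasing mono)) (decode a))) (code-decode {s} a))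
  bound : ∀ p → p ≤ᶠ section (g p)
  bound p rewrite decode-code (restrict B f (decode p)) with mapLetter-restrict B f (decode p)
  ... | inj₁ ≺p = <⇒≤ (subst (_<ᶠ code (mapLetter f (restrict B f (decode p)))) (code-decode {r} p) (code-anti ≺p))
  ... | inj₂ ≡p = ≤-reflexive (cong toℕ (trans (≡-sym (code-decode {r} p)) (cong code (≡-sym ≡p))))

-- The Ramsey theorem for ordered partite graphs

does-true : ∀ {P : Set} (d : Dec P) → does d ≡ true → P
does-true (yes p) _ = p

∨-true : ∀ {a b} → a ∨ b ≡ true → a ≡ true ⊎ b ≡ true
∨-true {true}  _ = inj₁ refl
∨-true {false} e = inj₂ e

∧-true : ∀ {a b} → a ∧ b ≡ true → a ≡ true × b ≡ true
∧-true {true} e = refl , e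

funToFin-cong : ∀ {m n} {f g : Fin m → Fin n} → f ≗ g → funToFin f ≡ funToFin g
funToFin-cong {zero}  f≗g = refl
funToFin-cong {suc m} f≗g = cong₂ combine (f≗g zero) (funToFin-cong (f≗g ∘ suc))

toBit : Bool → Fin 2
toBit b = if b then suc zero else zero

fromBit : Fin 2 → Bool
fromBit zero    = false
fromBit (suc _) = true

fromBit-toBit : ∀ b → fromBit (toBit b) ≡ b
fromBit-toBit true  = refl
fromBit-toBit false = refl

vertex : ∀ {n N} → (Fin N → Bool) → Fin n → Fin (2 ^ N * n)
vertex b c = combine (funToFin (toBit ∘ b)) c

bit : ∀ {n} N → Fin (2 ^ N * n) → Fin N → Bool
bit {n} N v p = fromBit (finToFun (proj₁ (remQuot {2 ^ N} n v)) p)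

class : ∀ {n} N → Fin (2 ^ N * n) → Fin n
class {n} N v = proj₂ (remQuot {2 ^ N} n v)

bit-vertex : ∀ {n N} (b : Fin N → Bool) (c : Fin n) → bit N (vertex b c) ≗ b
bit-vertex b c p = trans (cong (λ q → fromBit (finToFun (proj₁ q) p)) (remQuot-combine (funToFin (toBit ∘ b)) c))
  (trans (cong fromBit (finToFun-funToFin (toBit ∘ b) p)) (fromBit-toBit (b p)))

class-vertex : ∀ {n N} (b : Fin N → Bool) (c : Fin n) → class N (vertex b c) ≡ c
class-vertex b c = cong proj₂ (remQuot-combine (funToFin (toBit ∘ b)) c)

Meet : ∀ {n} N → Fin (2 ^ N * n) → Fin (2 ^ N * n) → Set
Meet N u v = class N u ≢ class N v × ∃ λ p → bit N u p ≡ true × bit N v p ≡ true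

meet? : ∀ {n} N (u v : Fin (2 ^ N * n)) → Dec (Meet N u v)
meet? N u v = ¬? (class N u ≟ᶠ class N v) ×-dec any? (λ p → bit N u p ≟ᵇ true ×-dec bit N v p ≟ᵇ true)

meet-sym : ∀ {n} N {u v : Fin (2 ^ N * n)} → Meet N u v → Meet N v u
meet-sym N (≢ , p , pu , pv) = (≢ ∘ ≡-sym) , p , pv , pu

does-cong : ∀ {P Q : Set} (p : Dec P) (q : Dec Q) → (P → Q) → (Q → P) → does p ≡ does q
does-cong p q f g = bool-ext (dec-true q ∘ f ∘ does-true p) (dec-true p ∘ g ∘ does-true q)

intersectionGraph : ∀ n N → Partite n (2 ^ N * n)
intersectionGraph n N = record
  { adj      = λ u v → does (meet? N u v)
  ; adj-sym  = λ u v → does-cong (meet? N u v) (meet? N v u) (meet-sym N) (meet-sym N)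
  ; part     = class N
  ; adj-part = λ u v e → proj₁ (does-true (meet? N u v) e)
  }

module _ {n r N : ℕ} (B : Partite n r) (w : Rigid N (r + r * r)) where
  bits : Fin r → Fin (suc N) → Bool
  bits y p = contains B (decode (w at p)) y

  place : Fin r → Fin (2 ^ suc N * n)
  place y = vertex (bits y) (part B y)

  private
    Z = intersectionGraph n (suc N)

    at-code : (a : Letter r) → ∃ λ p → decode {r} (w at p) ≡ a
    at-code a = let p , eq = at-surjective w (code a) in p , trans (cong (decode {r}) eq) (decode-code a)

    place-class : ∀ y → class (suc N) (place y) ≡ part B y
    place-class y = class-vertex (bits y) (part B y)

  -- Some position carries the letter `single x`, and it belongs to the set of `x` alone.
  place-injective : Injective _≡_ _≡_ place
  place-injective {x} {y} eq = does-true (x ≟ᶠ y) contains-y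
    where
    p = proj₁ (at-code (single x))
    p-eq = proj₂ (at-code (single x))
    contains-y : contains B (single x) y ≡ true
    contains-y = trans (cong (λ a → contains B a y) (≡-sym p-eq))
      (trans (≡-sym (bit-vertex (bits y) (part B y) p))
        (trans (cong (λ v → bit (suc N) v p) (≡-sym eq))
          (trans (bit-vertex (bits x) (part B x) p)
            (trans (cong (λ a → contains B a x) p-eq) (dec-true (x ≟ᶠ x) refl)))))

  private
    -- Only a pair can have two different elements, and it has elements only if it is an edge.
    contains-both : ∀ a {x y} → x ≢ y → contains B a x ≡ true → contains B a y ≡ true → adj B x y ≡ true
    contains-both (single z) x≢y ex ey =
      ⊥-elim (x≢y (trans (≡-sym (does-true (z ≟ᶠ _) ex)) (does-true (z ≟ᶠ _) ey)))
    contains-both (pair u v) {x} {y} x≢y ex ey with ∧-true ex | ∧-true ey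
    ... | adj-uv , ex′ | _ , ey′ with ∨-true {does (u ≟ᶠ x)} ex′ | ∨-true {does (u ≟ᶠ y)} ey′
    ... | inj₁ u≡x | inj₁ u≡y = ⊥-elim (x≢y (trans (≡-sym (does-true (u ≟ᶠ x) u≡x)) (does-true (u ≟ᶠ y) u≡y)))
    ... | inj₁ u≡x | inj₂ v≡y =
      subst₂ (λ a b → adj B a b ≡ true) (does-true (u ≟ᶠ x) u≡x) (does-true (v ≟ᶠ y) v≡y) adj-uv
    ... | inj₂ v≡x | inj₁ u≡y = trans (adj-sym B x y)
      (subst₂ (λ a b → adj B a b ≡ true) (does-true (u ≟ᶠ y) u≡y) (does-true (v ≟ᶠ x) v≡x) adj-uv)
    ... | inj₂ v≡x | inj₂ v≡y = ⊥-elim (x≢y (trans (≡-sym (does-true (v ≟ᶠ x) v≡x)) (does-true (v ≟ᶠ y) v≡y)))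

    forth : ∀ x y → adj B x y ≡ true → Meet (suc N) (place x) (place y)
    forth x y e = (λ eq → adj-part B x y e (trans (≡-sym (place-class x)) (trans eq (place-class y))))
      , p , trans (bit-vertex (bits x) (part B x) p) (trans (cong (λ a → contains B a x) p-eq) has-x)
          , trans (bit-vertex (bits y) (part B y) p) (trans (cong (λ a → contains B a y) p-eq) has-y)
      where
      p = proj₁ (at-code (pair x y))
      p-eq = proj₂ (at-code (pair x y))
      has-x : contains B (pair x y) x ≡ true
      has-x rewrite e | dec-true (x ≟ᶠ x) refl = refl
      has-y : contains B (pair x y) y ≡ true
      has-y rewrite e | dec-true (y ≟ᶠ y) refl with does (x ≟ᶠ y)
      ... | true  = refl
      ... | false = refl

    back : ∀ x y → Meet (suc N) (place x) (place y) → adj B x y ≡ true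
    back x y (≢ , p , px , py) = contains-both (decode (w at p)) (λ { refl → ≢ refl })
      (trans (≡-sym (bit-vertex (bits x) (part B x) p)) px) (trans (≡-sym (bit-vertex (bits y) (part B y) p)) py)

  place-adj : ∀ x y → adj B x y ≡ adj Z (place x) (place y)
  place-adj x y = bool-ext (dec-true (meet? (suc N) (place x) (place y)) ∘ forth x y)
    (back x y ∘ does-true (meet? (suc N) (place x) (place y)))

  place-embedding : IsEmbedding (graph B) (graph Z) place
  place-embedding = place-injective , place-adj

  place-part : ∀ y → part Z (place y) ≡ part B y
  place-part = place-class

-- The columns of the subgraph are the restrictions of the columns of `B`. So the copies of `A`
-- along monotone maps inside the copy given by `w` come from words that factor through `w`, which
-- is what the dual Ramsey theorem controls.
place-restriction : ∀ {n s r N} {A : Partite n s} {B : Partite n r} {f} (mono : Monotone A B f)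
  (w : Rigid N (r + r * r)) → place B w ∘ f ≗ place A (w ⨟ proj₁ (restriction mono))
place-restriction {A = A} {B} {f} mono w x = cong₂ combine
  (funToFin-cong (λ p → cong toBit (≡-sym (eq p)))) (≡-sym (part-pres mono x))
  where
  u = proj₁ (restriction mono)
  eq : ∀ p → contains A (decode ((w ⨟ u) at p)) x ≡ contains B (decode (w at p)) (f x)
  eq p = trans (cong (λ i → contains A (decode i) x) (trans (⨟-at w u p) (proj₂ (restriction mono) (w at p))))
    (trans (cong (λ a → contains A a x) (decode-code (restrict B f (decode (w at p)))))
      (contains-restrict mono (decode (w at p)) x))

EmbeddingColouring : ∀ {n s z} → Partite n s → Partite n z → ℕ → Set
EmbeddingColouring {s = s} {z} A Z k = (g : Fin s → Fin z) → IsEmbedding (graph A) (graph Z) g → Fin k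

Extensional : ∀ {n s z k} (A : Partite n s) (Z : Partite n z) → EmbeddingColouring A Z k → Set
Extensional A Z χ = ∀ g h p q → g ≗ h → χ g p ≡ χ h q

record Homogeneous {n s t r z k : ℕ} (A : Fin t → Partite n s) (B : Partite n r) (Z : Partite n z)
    (χ : ∀ i → EmbeddingColouring (A i) Z k) : Set where
  field
    copy      : Fin r → Fin z
    embedding : IsEmbedding (graph B) (graph Z) copy
    part-copy : ∀ y → part Z (copy y) ≡ part B y
    colourOf  : Fin t → Fin k
    constant  : ∀ i f → Monotone (A i) B f → ∀ e → χ i (copy ∘ f) e ≡ colourOf i

abstract
  -- All patterns are treated at once: a word is coloured by the tuple of the colours of the `t`
  -- copies that it places.
  partite-ramsey : ∀ {n s t r} (A : Fin t → Partite n s) (B : Partite n r) k → Σ ℕ λ z → Σ (Partite n z) λ Z →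
    (χ : ∀ i → EmbeddingColouring (A i) Z (suc k)) → (∀ i → Extensional (A i) Z (χ i)) → Homogeneous A B Z χ
  partite-ramsey {n} {s} {t} {r} A B k with dual-ramsey (s + s * s) (r + r * r) (suc k ^ t)
  ... | N , ramsey = 2 ^ suc N * n , intersectionGraph n (suc N) , homogeneous
    where
    module _ (χ : ∀ i → EmbeddingColouring (A i) (intersectionGraph n (suc N)) (suc k))
             (ext : ∀ i → Extensional (A i) (intersectionGraph n (suc N)) (χ i)) where
      colours : Rigid N (s + s * s) → Fin t → Fin (suc k)
      colours w i = χ i (place (A i) w) (place-embedding (A i) w)

      -- `dual-ramsey` has one colour more than there are tuples. The codes are shifted by `suc`,
      -- and `zero`, which no word receives, is read as a default.
      read : Fin (suc (suc k ^ t)) → Fin t → Fin (suc k)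
      read zero    i = zero
      read (suc c) i = finToFun c i

      w = proj₁ (ramsey (suc ∘ funToFin ∘ colours))
      c = proj₁ (proj₂ (ramsey (suc ∘ funToFin ∘ colours)))
      w-eq = proj₂ (proj₂ (ramsey (suc ∘ funToFin ∘ colours)))

      constant′ : ∀ i f → Monotone (A i) B f → ∀ e → χ i (place B w ∘ f) e ≡ read c i
      constant′ i f mono e = trans (ext i _ _ e (place-embedding (A i) (w ⨟ u)) (place-restriction mono w))
        (trans (≡-sym (finToFun-funToFin (colours (w ⨟ u)) i)) (cong (λ c → read c i) (w-eq u)))
        where u = proj₁ (restriction mono)

      homogeneous : Homogeneous A B (intersectionGraph n (suc N)) χ
      homogeneous = record
        { copy      = place B w
        ; embedding = place-embedding B w
        ; part-copy = place-part B w
        ; colourOf  = read c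
        ; constant  = constant′
        }

-- Extensions up to isomorphism

open Inverse using (to; from; strictlyInverseˡ; strictlyInverseʳ)

comprehension : ∀ {s} {P : Fin s → Set} → (∀ x → Dec (P x)) → Subset s
comprehension P? = tabulate (does ∘ P?)

∈-comprehension⁺ : ∀ {s} {P : Fin s → Set} (P? : ∀ x → Dec (P x)) {x} → P x → x ∈ comprehension P?
∈-comprehension⁺ P? {x} px = lookup⇒[]= x _ (trans (lookup∘tabulate (does ∘ P?) x) (dec-true (P? x) px))

∈-comprehension⁻ : ∀ {s} {P : Fin s → Set} (P? : ∀ x → Dec (P x)) {x} → x ∈ comprehension P? → P x
∈-comprehension⁻ P? {x} x∈ = does-true (P? x) (trans (≡-sym (lookup∘tabulate (does ∘ P?) x)) ([]=⇒lookup x∈))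

injective⇒↔ : ∀ {s} (f : Fin s → Fin s) → Injective _≡_ _≡_ f → Σ (Fin s ↔ Fin s) λ g → to g ≡ f
injective⇒↔ {s} f inj = mk↔ₛ′ f (proj₁ ∘ surjective) (proj₂ ∘ surjective) (λ x → inj (proj₂ (surjective (f x)))) , refl
  where
  missed : ∀ {s} (f : Fin s → Fin s) → Injective _≡_ _≡_ f → ∀ y → ¬ (∀ x → y ≢ f x)
  missed {suc s} f inj y miss with pigeonhole (n<1+n s) (λ x → punchOut (miss x))
  ... | i , j , i<j , eq = <⇒≢ i<j (inj (punchOut-injective (miss i) (miss j) eq))

  surjective : ∀ y → ∃ λ x → f x ≡ y
  surjective y with any? (λ x → f x ≟ᶠ y)
  ... | yes p = p
  ... | no ¬p = ⊥-elim (missed f inj y λ x y≡fx → ¬p (x , ≡-sym y≡fx))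

record Ranking {s M : ℕ} (key : Fin s → Fin M) : Set where
  field
    ranks    : Fin s ↔ Fin s
    key⇒rank : ∀ x y → key x <ᶠ key y → to ranks x <ᶠ to ranks y
    rank⇒key : ∀ x y → to ranks x <ᶠ to ranks y → key x <ᶠ key y
open Ranking

abstract
  ranking : ∀ {s M} (key : Fin s → Fin M) → Injective _≡_ _≡_ key → Ranking key
  ranking {s} key inj = record
    { ranks    = proj₁ (injective⇒↔ r r-injective)
    ; key⇒rank = r-mono
    ; rank⇒key = r-reflects
    }
    where
    below : Fin s → Subset s
    below x = comprehension (λ y → key y <ᶠ? key x)

    count< : ∀ x → ∣ below x ∣ < s
    count< x = subst (∣ below x ∣ <_) (∣⊤∣≡n s)
      (p⊂q⇒∣p∣<∣q∣ ((λ _ → ∈⊤) , x , ∈⊤ , λ x∈ → <ᶠ-irrefl refl (∈-comprehension⁻ (λ y → key y <ᶠ? key x) x∈)))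

    r : Fin s → Fin s
    r x = fromℕ< (count< x)

    r-mono : ∀ x y → key x <ᶠ key y → r x <ᶠ r y
    r-mono x y x<y = subst₂ _<_ (≡-sym (toℕ-fromℕ< (count< x))) (≡-sym (toℕ-fromℕ< (count< y)))
      (p⊂q⇒∣p∣<∣q∣ ((λ {z} z∈ → ∈-comprehension⁺ (λ z → key z <ᶠ? key y)
          (<ᶠ-trans {i = key z} (∈-comprehension⁻ (λ z → key z <ᶠ? key x) z∈) x<y))
        , x , ∈-comprehension⁺ (λ z → key z <ᶠ? key y) x<y
        , λ x∈ → <ᶠ-irrefl refl (∈-comprehension⁻ (λ z → key z <ᶠ? key x) x∈)))

    r-reflects : ∀ x y → r x <ᶠ r y → key x <ᶠ key y
    r-reflects x y rx<ry with <ᶠ-cmp (key x) (key y)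
    ... | tri< x<y _ _ = x<y
    ... | tri≈ _ x≡y _ = ⊥-elim (<ᶠ-irrefl (cong r (inj x≡y)) rx<ry)
    ... | tri> _ _ y<x = ⊥-elim (<ᶠ-asym rx<ry (r-mono y x y<x))

    r-injective : Injective _≡_ _≡_ r
    r-injective {x} {y} eq with <ᶠ-cmp (key x) (key y)
    ... | tri< x<y _ _ = ⊥-elim (<ᶠ-irrefl eq (r-mono x y x<y))
    ... | tri≈ _ x≡y _ = inj x≡y
    ... | tri> _ _ y<x = ⊥-elim (<ᶠ-irrefl (≡-sym eq) (r-mono y x y<x))

sortedBy : ∀ {n} (G : Graph) (c : Fin (size G) → Fin n) → ProperColouring n G c → Extension n G
sortedBy G c proper-c = record { rank = ranks R ; colour = c ; proper = proper-c ; monotone = mono }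
  where
  R = ranking (λ x → combine (c x) x) (λ {x} {y} → combine-injectiveʳ (c x) x (c y) y)
  mono : ∀ x y → to (ranks R) x <ᶠ to (ranks R) y → c x ≤ᶠ c y
  mono x y x<y = ≮⇒≥ λ cy<cx → <ᶠ-asym (rank⇒key R x y x<y) (combine-monoˡ-< y x cy<cx)

module _ {n : ℕ} {G : Graph} (X : Graph) (e : Extension n G) (h : Fin (size X) → Fin (size G)) (emb : IsEmbedding X G h) where
  inducedRanking : Ranking (to (rank e) ∘ h)
  inducedRanking = ranking (to (rank e) ∘ h) λ {x} {y} eq → proj₁ emb
    (trans (≡-sym (strictlyInverseʳ (rank e) (h x))) (trans (cong (from (rank e)) eq) (strictlyInverseʳ (rank e) (h y))))

  induced : Extension n X
  induced = record
    { rank     = ranks inducedRanking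
    ; colour   = colour e ∘ h
    ; proper   = λ x y xy → proper e (h x) (h y) (trans (≡-sym (proj₂ emb x y)) xy)
    ; monotone = λ x y x<y → monotone e (h x) (h y) (rank⇒key inducedRanking x y x<y)
    }

-- The vertices are renamed by their ranks, which turns the order into that of `Fin`.
canonical : ∀ {n X} → Extension n X → Partite n (size X)
canonical {n} {X} e = record
  { adj      = λ i j → E X (from (rank e) i) (from (rank e) j)
  ; adj-sym  = λ i j → sym X _ _
  ; part     = colour e ∘ from (rank e)
  ; adj-part = λ i j → proper e _ _
  }

module _ {n : ℕ} {X : Graph} where
  -- Since an order isomorphism of finite linear orders is unique, isomorphism can be decided by
  -- comparing the structures transported along the ranks.
  infix 4 _≈_
  record _≈_ (e₁ e₂ : Extension n X) : Set where
    constructor same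
    field
      same-adj  : ∀ i j → adj (canonical e₁) i j ≡ adj (canonical e₂) i j
      same-part : ∀ i → part (canonical e₁) i ≡ part (canonical e₂) i

  _≈?_ : ∀ e₁ e₂ → Dec (e₁ ≈ e₂)
  e₁ ≈? e₂ = map′ (uncurry same) (λ (same a p) → a , p)
    (all? (λ i → all? λ j → _ ≟ᵇ _) ×-dec all? (λ i → _ ≟ᶠ _))

  ≈-sym : ∀ {e₁ e₂} → e₁ ≈ e₂ → e₂ ≈ e₁
  ≈-sym (same a p) = same (λ i j → ≡-sym (a i j)) λ i → ≡-sym (p i)

  ≈-trans : ∀ {e₁ e₂ e₃} → e₁ ≈ e₂ → e₂ ≈ e₃ → e₁ ≈ e₃
  ≈-trans (same a p) (same b q) = same (λ i j → trans (a i j) (b i j)) λ i → trans (p i) (q i)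

  ≈⇒Isomorphic : ∀ {e₁ e₂} → e₁ ≈ e₂ → Isomorphic e₁ e₂
  ≈⇒Isomorphic {e₁} {e₂} (same a p) = mk↔ₛ′ g g⁻¹ inverseˡ inverseʳ , edges , order , colours
    where
    r₁ = rank e₁
    r₂ = rank e₂
    g = from r₂ ∘ to r₁
    g⁻¹ = from r₁ ∘ to r₂
    inverseˡ : ∀ y → g (g⁻¹ y) ≡ y
    inverseˡ y = trans (cong (from r₂) (strictlyInverseˡ r₁ (to r₂ y))) (strictlyInverseʳ r₂ y)
    inverseʳ : ∀ x → g⁻¹ (g x) ≡ x
    inverseʳ x = trans (cong (from r₁) (strictlyInverseˡ r₂ (to r₁ x))) (strictlyInverseʳ r₁ x)
    edges : ∀ x y → E X x y ≡ E X (g x) (g y)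
    edges x y = trans (≡-sym (cong₂ (E X) (strictlyInverseʳ r₁ x) (strictlyInverseʳ r₁ y))) (a (to r₁ x) (to r₁ y))
    order : ∀ x y → (to r₁ x <ᶠ to r₁ y) ⇔ (to r₂ (g x) <ᶠ to r₂ (g y))
    order x y = mk⇔ (subst₂ _<ᶠ_ (≡-sym (strictlyInverseˡ r₂ _)) (≡-sym (strictlyInverseˡ r₂ _)))
                    (subst₂ _<ᶠ_ (strictlyInverseˡ r₂ _) (strictlyInverseˡ r₂ _))
    colours : ∀ x → colour e₂ (g x) ≡ colour e₁ x
    colours x = trans (≡-sym (p (to r₁ x))) (cong (colour e₁) (strictlyInverseʳ r₁ x))

increasing⇒≥ : ∀ {s} (h : Fin s → ℕ) b → (∀ i → b ≤ h i) → (∀ i j → i <ᶠ j → h i < h j) → ∀ i → b + toℕ i ≤ h i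
increasing⇒≥ h b b≤ inc zero    = subst (_≤ h zero) (≡-sym (+-identityʳ b)) (b≤ zero)
increasing⇒≥ h b b≤ inc (suc i) = subst (_≤ h (suc i)) (≡-sym (+-suc b (toℕ i)))
  (increasing⇒≥ (h ∘ suc) (suc b) (λ j → ≤-trans (s≤s (b≤ zero)) (inc zero (suc j) (s≤s z≤n)))
    (λ j k j<k → inc (suc j) (suc k) (s≤s j<k)) i)

-- A strictly increasing map lies above the identity. For `f` at `i` and for `g` at `f i` this gives
-- the two inequalities.
increasing-inverse⇒id : ∀ {s} {f g : Fin s → Fin s} → (∀ i j → i <ᶠ j → f i <ᶠ f j) → (∀ i j → i <ᶠ j → g i <ᶠ g j) →
  (∀ i → g (f i) ≡ i) → ∀ i → f i ≡ i
increasing-inverse⇒id {f = f} {g} f-inc g-inc gf i = toℕ-injective (≤-antisym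
  (subst (λ x → f i ≤ᶠ x) (gf i) (increasing⇒≥ (toℕ ∘ g) 0 (λ _ → z≤n) g-inc (f i)))
  (increasing⇒≥ (toℕ ∘ f) 0 (λ _ → z≤n) f-inc i))

-- Read on ranks, the isomorphism is increasing with an increasing inverse, hence the identity.
Isomorphic⇒≈ : ∀ {n X} {e₁ e₂ : Extension n X} → Isomorphic e₁ e₂ → e₁ ≈ e₂
Isomorphic⇒≈ {n} {X} {e₁} {e₂} (f , edges , order , colours) =
  same (λ i j → trans (edges _ _) (cong₂ (E X) (g-from i) (g-from j)))
  (λ i → trans (≡-sym (colours _)) (cong (colour e₂) (g-from i)))
  where
  r₁ = rank e₁
  r₂ = rank e₂
  shift = to r₂ ∘ to f ∘ from r₁
  shift⁻¹ = to r₁ ∘ from f ∘ from r₂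

  shift-inc : ∀ i j → i <ᶠ j → shift i <ᶠ shift j
  shift-inc i j i<j = Equivalence.to (order (from r₁ i) (from r₁ j))
    (subst₂ _<ᶠ_ (≡-sym (strictlyInverseˡ r₁ i)) (≡-sym (strictlyInverseˡ r₁ j)) i<j)

  shift⁻¹-inc : ∀ i j → i <ᶠ j → shift⁻¹ i <ᶠ shift⁻¹ j
  shift⁻¹-inc i j i<j = Equivalence.from (order (from f (from r₂ i)) (from f (from r₂ j)))
    (subst₂ _<ᶠ_ (≡-sym (cancel i)) (≡-sym (cancel j)) i<j)
    where
    cancel : ∀ i → to r₂ (to f (from f (from r₂ i))) ≡ i
    cancel i = trans (cong (to r₂) (strictlyInverseˡ f (from r₂ i))) (strictlyInverseˡ r₂ i)

  shift-inverse : ∀ i → shift⁻¹ (shift i) ≡ i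
  shift-inverse i = trans (cong (to r₁ ∘ from f) (strictlyInverseʳ r₂ _))
    (trans (cong (to r₁) (strictlyInverseʳ f _)) (strictlyInverseˡ r₁ i))

  g-from : ∀ i → to f (from r₁ i) ≡ from r₂ i
  g-from i = trans (≡-sym (strictlyInverseʳ r₂ _))
    (cong (from r₂) (increasing-inverse⇒id shift-inc shift⁻¹-inc shift-inverse i))

record Representatives {A : Set} (_~_ : A → A → Set) (P : A → Set) : Set where
  field
    number   : ℕ
    rep      : Fin number → A
    distinct : ∀ i j → rep i ~ rep j → i ≡ j
    complete : ∀ a → P a → ∃ λ i → a ~ rep i
open Representatives

representatives : ∀ {A : Set} {_~_ : A → A → Set} → (∀ a b → Dec (a ~ b)) → (∀ {a b} → a ~ b → b ~ a) →
  (∀ a → a ~ a) → ∀ M (candidate : Fin M → Maybe A) → Representatives _~_ (λ a → ∃ λ q → candidate q ≡ just a)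
representatives _~?_ ~sym ~refl zero candidate = record
  { number = 0 ; rep = λ () ; distinct = λ () ; complete = λ { _ (() , _) } }
representatives {A} {_~_} _~?_ ~sym ~refl (suc M) candidate
  with representatives _~?_ ~sym ~refl M (candidate ∘ suc) | candidate zero in eq
... | R | nothing = record
  { number = number R ; rep = rep R ; distinct = distinct R
  ; complete = λ { a (zero , e) → ⊥-elim (nothing≢just (trans (≡-sym eq) e)) ; a (suc q , e) → complete R a (q , e) } }
  where
  nothing≢just : ∀ {a : A} → nothing ≢ just a
  nothing≢just ()
... | R | just a₀ with any? (λ i → a₀ ~? rep R i)
... | yes (i , a₀~i) = record
  { number = number R ; rep = rep R ; distinct = distinct R ; complete = found }
  where
  found : ∀ a → (∃ λ q → candidate q ≡ just a) → ∃ λ i → a ~ rep R i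
  found a (zero , e) with trans (≡-sym eq) e
  ... | refl = i , a₀~i
  found a (suc q , e) = complete R a (q , e)
... | no unseen = record
  { number = suc (number R) ; rep = rep′ ; distinct = distinct′ ; complete = found }
  where
  rep′ : Fin (suc (number R)) → A
  rep′ zero    = a₀
  rep′ (suc i) = rep R i
  distinct′ : ∀ i j → rep′ i ~ rep′ j → i ≡ j
  distinct′ zero    zero    _ = refl
  distinct′ zero    (suc j) e = ⊥-elim (unseen (j , e))
  distinct′ (suc i) zero    e = ⊥-elim (unseen (i , ~sym e))
  distinct′ (suc i) (suc j) e = cong suc (distinct R i j e)
  found : ∀ a → (∃ λ q → candidate q ≡ just a) → ∃ λ i → a ~ rep′ i
  found a (zero , e) with trans (≡-sym eq) e
  ... | refl = zero , ~refl a₀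
  found a (suc q , e) = let i , a~i = complete R a (q , e) in suc i , a~i

module _ (n : ℕ) (X : Graph) where
  private
    s = size X

  -- Here π lists the vertices in increasing order, so it is the inverse of the rank.
  Valid : (Fin s → Fin n) → (Fin s → Fin s) → Set
  Valid c π = (∀ i j → π i ≡ π j → i ≡ j) × (∀ x y → E X x y ≡ true → c x ≢ c y) × (∀ i j → i <ᶠ j → c (π i) ≤ᶠ c (π j))

  valid? : ∀ c π → Dec (Valid c π)
  valid? c π = all? (λ i → all? λ j → (π i ≟ᶠ π j) →-dec (i ≟ᶠ j))
    ×-dec all? (λ x → all? λ y → (E X x y ≟ᵇ true) →-dec ¬? (c x ≟ᶠ c y))
    ×-dec all? (λ i → all? λ j → (i <ᶠ? j) →-dec (c (π i) ≤ᶠ? c (π j)))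

  listed : ∀ {c π} → Valid c π → Extension n X
  listed {c} {π} (inj , proper-c , mono) = record
    { rank     = mk↔ₛ′ (from g) π (strictlyInverseʳ g) (strictlyInverseˡ g)
    ; colour   = c
    ; proper   = proper-c
    ; monotone = λ x y x<y → subst₂ (λ u v → c u ≤ᶠ c v) (strictlyInverseˡ g x) (strictlyInverseˡ g y) (mono _ _ x<y)
    }
    where g = proj₁ (injective⇒↔ π (λ {i} {j} → inj i j))

  candidateFor : ∀ {c π} → Dec (Valid c π) → Maybe (Extension n X)
  candidateFor (yes v) = just (listed v)
  candidateFor (no _)  = nothing

  colouringAt : Fin (n ^ s * s ^ s) → Fin s → Fin n
  colouringAt q = finToFun (proj₁ (remQuot {n ^ s} (s ^ s) q))

  orderAt : Fin (n ^ s * s ^ s) → Fin s → Fin s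
  orderAt q = finToFun (proj₂ (remQuot {n ^ s} (s ^ s) q))

  listing : ∀ c π → ∃ λ q → (∀ x → colouringAt q x ≡ c x) × (∀ i → orderAt q i ≡ π i)
  listing c π = combine (funToFin c) (funToFin π) ,
    (λ x → trans (cong (λ q → finToFun (proj₁ q) x) (remQuot-combine (funToFin c) (funToFin π))) (finToFun-funToFin c x)) ,
    (λ i → trans (cong (λ q → finToFun (proj₂ q) i) (remQuot-combine (funToFin c) (funToFin π))) (finToFun-funToFin π i))

  candidate : Fin (n ^ s * s ^ s) → Maybe (Extension n X)
  candidate q = candidateFor (valid? (colouringAt q) (orderAt q))

  -- Decoding recovers the colouring and the order only pointwise, so an extension is met in the
  -- list up to `≈`.
  listed-≈ : ∀ (e : Extension n X) {c π} → c ≗ colour e → π ≗ from (rank e) → (v? : Dec (Valid c π)) →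
    ∃ λ e′ → candidateFor v? ≡ just e′ × e ≈ e′
  listed-≈ e c≗ π≗ (yes v) = listed v , refl ,
    same (λ i j → ≡-sym (cong₂ (E X) (π≗ i) (π≗ j))) λ i → ≡-sym (trans (c≗ _) (cong (colour e) (π≗ i)))
  listed-≈ e {c} {π} c≗ π≗ (no ¬v) = ⊥-elim (¬v (inj , proper-c , mono))
    where
    inj : ∀ i j → π i ≡ π j → i ≡ j
    inj i j eq = trans (≡-sym (strictlyInverseˡ (rank e) i))
      (trans (cong (to (rank e)) (trans (≡-sym (π≗ i)) (trans eq (π≗ j)))) (strictlyInverseˡ (rank e) j))
    proper-c : ∀ x y → E X x y ≡ true → c x ≢ c y
    proper-c x y xy cx≡cy = proper e x y xy (trans (≡-sym (c≗ x)) (trans cx≡cy (c≗ y)))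
    mono : ∀ i j → i <ᶠ j → c (π i) ≤ᶠ c (π j)
    mono i j i<j = subst₂ _≤ᶠ_ (≡-sym (trans (c≗ _) (cong (colour e) (π≗ i)))) (≡-sym (trans (c≗ _) (cong (colour e) (π≗ j))))
      (monotone e _ _ (subst₂ _<ᶠ_ (≡-sym (strictlyInverseˡ (rank e) i)) (≡-sym (strictlyInverseˡ (rank e) j)) i<j))

  abstract
    extensions : Representatives (_≈_ {n} {X}) (λ e → ∃ λ q → candidate q ≡ just e)
    extensions = representatives _≈?_ ≈-sym (λ e → same (λ i j → refl) λ i → refl) (n ^ s * s ^ s) candidate

    classify : (e : Extension n X) → ∃ λ i → e ≈ rep extensions i
    classify e with listing (colour e) (from (rank e))
    ... | q , c≗ , π≗ with listed-≈ e c≗ π≗ (valid? (colouringAt q) (orderAt q))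
    ... | e′ , eq , e≈e′ with complete extensions e′ (q , eq)
    ... | i , e′≈i = i , ≈-trans e≈e′ e′≈i

    isTau : IsTau n X (number extensions)
    isTau = rep extensions , (λ i j iso → distinct extensions i j (Isomorphic⇒≈ iso)) ,
      λ e → let i , e≈i = classify e in i , ≈⇒Isomorphic e≈i

-- The upper bound

open _≈_

image : ∀ {s z} → (Fin s → Fin z) → Subset z
image g = comprehension (preimage? g)

image-copy : ∀ X Z {g} → IsEmbedding X Z g → IsCopy X Z (image g)
image-copy X Z {g} emb = g , emb , λ z → mk⇔ (∈-comprehension⁻ (preimage? g)) (∈-comprehension⁺ (preimage? g))

embedding-∘ : ∀ A B C {f g} → IsEmbedding A B f → IsEmbedding B C g → IsEmbedding A C (g ∘ f)
embedding-∘ A B C (f-inj , f-adj) (g-inj , g-adj) = f-inj ∘ g-inj , λ a b → trans (f-adj a b) (g-adj _ _)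

rank-embedding : ∀ {n X} (e : Extension n X) → IsEmbedding X (graph (canonical e)) (to (rank e))
rank-embedding {X = X} e = (λ {x} {y} eq → trans (≡-sym (strictlyInverseʳ (rank e) x))
    (trans (cong (from (rank e)) eq) (strictlyInverseʳ (rank e) y))) ,
  λ x y → ≡-sym (cong₂ (E X) (strictlyInverseʳ (rank e) x) (strictlyInverseʳ (rank e) y))

monotone-embedding : ∀ {n s r} {A : Partite n s} {B : Partite n r} {f} → Monotone A B f → IsEmbedding (graph A) (graph B) f
monotone-embedding mono = increasing⇒injective (increasing mono) , adj-pres mono

col-cong : ∀ {X Z k} (α : CopyColouring X Z k) {S S′} (p : IsCopy X Z S) (q : IsCopy X Z S′) → S ≡ S′ → col α S p ≡ col α S′ q
col-cong α p q refl = witness-irrelevant α _ p q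

image-cong : ∀ {s z} {g h : Fin s → Fin z} → g ≗ h → image g ≡ image h
image-cong {g = g} {h} g≗h = ⊆-antisym
  (λ z∈ → let x , eq = ∈-comprehension⁻ (preimage? g) z∈ in ∈-comprehension⁺ (preimage? h) (x , trans (≡-sym (g≗h x)) eq))
  (λ z∈ → let x , eq = ∈-comprehension⁻ (preimage? h) z∈ in ∈-comprehension⁺ (preimage? g) (x , trans (g≗h x) eq))

range : ∀ {t k} → (Fin t → Fin k) → Subset k
range {zero}  c = ∅
range {suc t} c = range (c ∘ suc) [ c zero ]≔ inside

∣insert∣≤ : ∀ {k} (p : Subset k) x → ∣ p [ x ]≔ inside ∣ ≤ suc ∣ p ∣
∣insert∣≤ (inside  ∷ p) zero    = n≤1+n _
∣insert∣≤ (outside ∷ p) zero    = ≤-refl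
∣insert∣≤ (inside  ∷ p) (suc x) = s≤s (∣insert∣≤ p x)
∣insert∣≤ (outside ∷ p) (suc x) = ∣insert∣≤ p x

∣range∣≤ : ∀ {t k} (c : Fin t → Fin k) → ∣ range c ∣ ≤ t
∣range∣≤ {zero}  {k} c = ≤-reflexive (∣⊥∣≡0 k)
∣range∣≤ {suc t}     c = ≤-trans (∣insert∣≤ (range (c ∘ suc)) (c zero)) (s≤s (∣range∣≤ (c ∘ suc)))

∈-range : ∀ {t k} (c : Fin t → Fin k) i → c i ∈ range c
∈-range c zero    = []≔-updates (range (c ∘ suc)) (c zero)
∈-range c (suc i) with c zero ≟ᶠ c (suc i)
... | yes eq = subst (_∈ range c) eq ([]≔-updates (range (c ∘ suc)) (c zero))
... | no  ≢  = []≔-minimal (range (c ∘ suc)) (c (suc i)) (c zero) (≢ ∘ ≡-sym) (∈-range (c ∘ suc) i)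

module _ {n : ℕ} {X : Graph} {z k : ℕ} (Z : Partite n z) (α : CopyColouring X (graph Z) k) (e : Extension n X) where
  embeddingColouring : EmbeddingColouring (canonical e) Z k
  embeddingColouring g emb = col α (image (g ∘ to (rank e)))
    (image-copy X (graph Z) (embedding-∘ X (graph (canonical e)) (graph Z) (rank-embedding e) emb))

  embeddingColouring-ext : Extensional (canonical e) Z embeddingColouring
  embeddingColouring-ext g h p q g≗h = col-cong α _ _ (image-cong (g≗h ∘ to (rank e)))

module _ {n : ℕ} {X Y : Graph} (eY : Extension n Y) h (emb : IsEmbedding X Y h)
         (e : Extension n X) (same-type : induced X eY h emb ≈ e) where
  private
    r = rank (induced X eY h emb)

  sorted : Fin (size X) → Fin (size Y)
  sorted = to (rank eY) ∘ h ∘ from r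

  -- Traversed in increasing order, a copy of X is a monotone image of the canonical form of its
  -- type, hence one of the patterns that `partite-ramsey` makes constant.
  sorted-monotone : Monotone (canonical e) (canonical eY) sorted
  sorted-monotone = record
    { increasing = λ i j i<j → rank⇒key (inducedRanking X eY h emb) _ _
        (subst₂ _<ᶠ_ (≡-sym (strictlyInverseˡ r i)) (≡-sym (strictlyInverseˡ r j)) i<j)
    ; adj-pres   = λ i j → trans (≡-sym (same-adj same-type i j)) (trans (proj₂ emb _ _)
        (≡-sym (cong₂ (E Y) (strictlyInverseʳ (rank eY) _) (strictlyInverseʳ (rank eY) _))))
    ; part-pres  = λ i → trans (≡-sym (same-part same-type i)) (≡-sym (cong (colour eY) (strictlyInverseʳ (rank eY) _)))
    }

  -- Sorting only permutes the vertices of a copy, and the colour of a copy depends on its vertex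
  -- set.
  image-sorted : ∀ {z} (φ : Fin (size Y) → Fin z) →
    image (φ ∘ sorted ∘ to (rank e)) ≡ image (φ ∘ to (rank eY) ∘ h)
  image-sorted φ = ⊆-antisym
    (λ z∈ → let x , eq = ∈-comprehension⁻ (preimage? (φ ∘ sorted ∘ to (rank e))) z∈ in
      ∈-comprehension⁺ (preimage? (φ ∘ to (rank eY) ∘ h)) (from r (to (rank e) x) , eq))
    (λ z∈ → let x , eq = ∈-comprehension⁻ (preimage? (φ ∘ to (rank eY) ∘ h)) z∈ in
      ∈-comprehension⁺ (preimage? (φ ∘ sorted ∘ to (rank e))) (from (rank e) (to r x) ,
        trans (cong (φ ∘ to (rank eY) ∘ h) (trans (cong (from r) (strictlyInverseˡ (rank e) (to r x))) (strictlyInverseʳ r x))) eq))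

copy-image : ∀ X Z {S} (p : IsCopy X Z S) → S ≡ image (proj₁ p)
copy-image X Z (f , _ , mem) = ⊆-antisym
  (λ {z} z∈ → ∈-comprehension⁺ (preimage? f) (Equivalence.to (mem z) z∈))
  (λ {z} z∈ → Equivalence.from (mem z) (∈-comprehension⁻ (preimage? f) z∈))

module _ (X Y Z : Graph) {ψ : Fin (size Y) → Fin (size Z)} (emb : IsEmbedding Y Z ψ)
         {S : Subset (size Z)} (p : IsCopy X Z S) (S⊆ : S ⊆ image ψ) where
  private
    f = proj₁ p

    lift : ∀ x → ∃ λ y → ψ y ≡ f x
    lift x = ∈-comprehension⁻ (preimage? ψ) (S⊆ (Equivalence.from (proj₂ (proj₂ p) (f x)) (x , refl)))

  factor : Fin (size X) → Fin (size Y)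
  factor = proj₁ ∘ lift

  factor-eq : ψ ∘ factor ≗ f
  factor-eq = proj₂ ∘ lift

  factor-embedding : IsEmbedding X Y factor
  factor-embedding =
    (λ {x} {y} eq → proj₁ (proj₁ (proj₂ p)) (trans (≡-sym (factor-eq x)) (trans (cong ψ eq) (factor-eq y)))) ,
    λ x y → trans (proj₂ (proj₁ (proj₂ p)) x y)
      (trans (cong₂ (E Z) (≡-sym (factor-eq x)) (≡-sym (factor-eq y))) (≡-sym (proj₂ emb _ _)))

-- The patterns are the canonical forms of the representatives, and Y is sorted by a colouring. On
-- the homogeneous copy of Y, the colour of a copy of X is a function of the index of its type.
upper-bound : ∀ n X → RamseyBound n X (number (extensions n X))
-- Without colours there can be no copy of X to be coloured, so Y itself serves.
upper-bound n X Y Y-colouring zero = Y , Y-colouring , λ α →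
  ⊤ , (id , (id , λ _ _ → refl) , λ z → mk⇔ (λ _ → z , refl) (λ _ → ∈⊤)) , [] , z≤n ,
  λ S p _ → ⊥-elim (no-colour (col α S p))
  where
  no-colour : Fin 0 → ⊥
  no-colour ()
upper-bound n X Y (c , c-proper) (suc k) = arrow (partite-ramsey (canonical ∘ reps) (canonical eY) k)
  where
  reps = rep (extensions n X)
  eY = sortedBy Y c c-proper

  arrow : (Σ ℕ λ z → Σ (Partite n z) λ Z → (χ : ∀ i → EmbeddingColouring (canonical (reps i)) Z (suc k)) →
      (∀ i → Extensional (canonical (reps i)) Z (χ i)) → Homogeneous (canonical ∘ reps) (canonical eY) Z χ) →
    Σ Graph λ Z → Colourable n Z × Arrow Z Y X (suc k) (number (extensions n X))
  arrow (z , Z , homogeneous) = graph Z , (part Z , adj-part Z) , λ α →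
    image (ψ α) , image-copy Y (graph Z) (ψ-embedding α) , range (colourOf (H α)) , ∣range∣≤ (colourOf (H α)) , colours∈ α
    where
    open Homogeneous
    H : (α : CopyColouring X (graph Z) (suc k)) → Homogeneous (canonical ∘ reps) (canonical eY) Z
      (λ i → embeddingColouring Z α (reps i))
    H α = homogeneous (λ i → embeddingColouring Z α (reps i)) (λ i → embeddingColouring-ext Z α (reps i))

    ψ : CopyColouring X (graph Z) (suc k) → Fin (size Y) → Fin z
    ψ α = copy (H α) ∘ to (rank eY)

    ψ-embedding : ∀ α → IsEmbedding Y (graph Z) (ψ α)
    ψ-embedding α = embedding-∘ Y (graph (canonical eY)) (graph Z) (rank-embedding eY) (embedding (H α))

    colours∈ : ∀ α S (p : IsCopy X (graph Z) S) → S ⊆ image (ψ α) → col α S p ∈ range (colourOf (H α))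
    colours∈ α S p S⊆ = subst (_∈ range (colourOf (H α))) (≡-sym col-eq) (∈-range (colourOf (H α)) i)
      where
      h = factor X Y (graph Z) (ψ-embedding α) p S⊆
      h-emb = factor-embedding X Y (graph Z) (ψ-embedding α) p S⊆
      i = proj₁ (classify n X (induced X eY h h-emb))
      same-type = proj₂ (classify n X (induced X eY h h-emb))
      f = sorted eY h h-emb (reps i) same-type
      mono = sorted-monotone eY h h-emb (reps i) same-type
      S-eq : S ≡ image (copy (H α) ∘ f ∘ to (rank (reps i)))
      S-eq = trans (copy-image X (graph Z) p) (trans (image-cong (λ x → ≡-sym (factor-eq X Y (graph Z) (ψ-embedding α) p S⊆ x)))
        (≡-sym (image-sorted eY h h-emb (reps i) same-type (copy (H α)))))
      col-eq : col α S p ≡ colourOf (H α) i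
      col-eq = trans (col-cong α p _ S-eq) (constant (H α) i f mono
        (embedding-∘ (graph (canonical (reps i))) (graph (canonical eY)) (graph Z) (monotone-embedding mono) (embedding (H α))))

-- The lower bound

same-part⇒non-adj : ∀ {n s} (A : Partite n s) {x y} → part A x ≡ part A y → false ≡ adj A x y
same-part⇒non-adj A {x} {y} eq = ≡-sym (≢true⇒false λ e → adj-part A x y e eq)

-- With one or two vertices these are the patterns of points and of pairs of points in the class
-- `d`.
isolated : ∀ {n} s → Fin n → Partite n s
isolated s d = record { adj = λ _ _ → false ; adj-sym = λ _ _ → refl ; part = λ _ → d ; adj-part = λ _ _ () }

point-monotone : ∀ {n s} (A : Partite n s) x → Monotone (isolated 1 (part A x)) A (λ _ → x)
point-monotone A x = record
  { increasing = λ { zero zero () } ; adj-pres = λ _ _ → same-part⇒non-adj A refl ; part-pres = λ _ → refl }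

two : ∀ {s : ℕ} → Fin s → Fin s → Fin 2 → Fin s
two x y zero    = x
two x y (suc _) = y

two-monotone : ∀ {n s} (A : Partite n s) {x y} → x <ᶠ y → part A x ≡ part A y →
  Monotone (isolated 2 (part A x)) A (two x y)
two-monotone A {x} {y} x<y eq = record
  { increasing = λ { zero zero () ; zero (suc zero) _ → x<y ; (suc zero) zero () ; (suc zero) (suc zero) (s≤s ()) }
  ; adj-pres   = λ i j → same-part⇒non-adj A (trans (≡-sym (part-two i)) (part-two j))
  ; part-pres  = part-two
  }
  where
  part-two : ∀ i → part A x ≡ part A (two x y i)
  part-two zero    = refl
  part-two (suc _) = eq

-- A rainbow clique, which makes the induced map on colours injective, together with
-- the blocks of all colourings c and orderings π of X.
module Universal (n : ℕ) (X : Graph) where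
  private
    s = size X
    Q = n ^ s * s ^ s

  Vertex : Set
  Vertex = Fin n ⊎ Fin Q × Fin s

  view : Fin (n + Q * s) → Vertex
  view v = map₂ (remQuot s) (splitAt n v)

  blockColour : Fin Q → Fin s → Fin n
  blockColour q = colouringAt n X q ∘ orderAt n X q

  vpart : Vertex → Fin n
  vpart (inj₁ d)       = d
  vpart (inj₂ (q , i)) = blockColour q i

  Adjacent : Vertex → Vertex → Set
  Adjacent (inj₁ d)       (inj₁ d′)        = Unit
  Adjacent (inj₂ (q , i)) (inj₂ (q′ , i′)) = q ≡ q′ × E X (orderAt n X q i) (orderAt n X q i′) ≡ true
  Adjacent _              _                = ⊥

  adjacent? : ∀ u v → Dec (Adjacent u v)
  adjacent? (inj₁ d)       (inj₁ d′)        = yes tt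
  adjacent? (inj₂ (q , i)) (inj₂ (q′ , i′)) = (q ≟ᶠ q′) ×-dec (E X (orderAt n X q i) (orderAt n X q i′) ≟ᵇ true)
  adjacent? (inj₁ _)       (inj₂ _)         = no λ ()
  adjacent? (inj₂ _)       (inj₁ _)         = no λ ()

  adjacent-sym : ∀ u v → Adjacent u v → Adjacent v u
  adjacent-sym (inj₁ d)       (inj₁ d′)        _          = tt
  adjacent-sym (inj₂ (q , i)) (inj₂ (q′ , i′)) (refl , e) = refl , trans (sym X _ _) e

  -- The blocks run over all pairs of maps, whether valid or not. Asking for different classes keeps
  -- the graph partite even where the colouring of a block is not proper.
  Linked : Vertex → Vertex → Set
  Linked u v = vpart u ≢ vpart v × Adjacent u v

  linked? : ∀ u v → Dec (Linked u v)
  linked? u v = ¬? (vpart u ≟ᶠ vpart v) ×-dec adjacent? u v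

  linked-sym : ∀ u v → Linked u v → Linked v u
  linked-sym u v (≢ , a) = ≢ ∘ ≡-sym , adjacent-sym u v a

  universal : Partite n (n + Q * s)
  universal = record
    { adj      = λ u v → does (linked? (view u) (view v))
    ; adj-sym  = λ u v → does-cong (linked? (view u) (view v)) (linked? (view v) (view u))
        (linked-sym (view u) (view v)) (linked-sym (view v) (view u))
    ; part     = vpart ∘ view
    ; adj-part = λ u v e → proj₁ (does-true (linked? (view u) (view v)) e)
    }

  clique : Fin n → Fin (n + Q * s)
  clique d = d ↑ˡ Q * s

  view-clique : ∀ d → view (clique d) ≡ inj₁ d
  view-clique d = cong (map₂ (remQuot s)) (splitAt-↑ˡ n d (Q * s))

  clique-adj : ∀ d d′ → d ≢ d′ → adj universal (clique d) (clique d′) ≡ true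
  clique-adj d d′ d≢d′ rewrite view-clique d | view-clique d′ = dec-true (linked? (inj₁ d) (inj₁ d′)) (d≢d′ , tt)

  block : Fin Q → Fin s → Fin (n + Q * s)
  block q i = n ↑ʳ combine q i

  view-block : ∀ q i → view (block q i) ≡ inj₂ (q , i)
  view-block q i = trans (cong (map₂ (remQuot s)) (splitAt-↑ʳ n (Q * s) (combine q i))) (cong inj₂ (remQuot-combine q i))

  block-mono : ∀ q {i j} → i <ᶠ j → block q i <ᶠ block q j
  block-mono q {i} {j} i<j = subst₂ _<_ (≡-sym (toℕ-↑ʳ n (combine q i))) (≡-sym (toℕ-↑ʳ n (combine q j)))
    (+-monoʳ-< n (combine-monoʳ-< q i<j))

  module _ (c : Fin s → Fin n) (c-proper : ProperColouring n X c) (r : Fin s ↔ Fin s) where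
    private
      q = proj₁ (listing n X c (from r))
      c-eq = proj₁ (proj₂ (listing n X c (from r)))
      π-eq = proj₂ (proj₂ (listing n X c (from r)))

    blockOf : Fin s → Fin (n + Q * s)
    blockOf x = block q (to r x)

    private
      order-at : ∀ x → orderAt n X q (to r x) ≡ x
      order-at x = trans (π-eq (to r x)) (strictlyInverseʳ r x)

      colour-at : ∀ x → blockColour q (to r x) ≡ c x
      colour-at x = trans (c-eq _) (cong c (order-at x))

    blockOf-part : ∀ x → part universal (blockOf x) ≡ c x
    blockOf-part x = trans (cong vpart (view-block q (to r x))) (colour-at x)

    blockOf-adj : ∀ x y → E X x y ≡ adj universal (blockOf x) (blockOf y)
    blockOf-adj x y rewrite view-block q (to r x) | view-block q (to r y) = bool-ext
      (λ e → dec-true (linked? (inj₂ (q , to r x)) (inj₂ (q , to r y)))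
        ((λ eq → c-proper x y e (trans (≡-sym (colour-at x)) (trans eq (colour-at y)))) ,
         refl , trans (cong₂ (E X) (order-at x) (order-at y)) e))
      (λ e → trans (cong₂ (E X) (≡-sym (order-at x)) (≡-sym (order-at y)))
        (proj₂ (proj₂ (does-true (linked? (inj₂ (q , to r x)) (inj₂ (q , to r y))) e))))

    blockOf-mono : ∀ {x y} → to r x <ᶠ to r y → blockOf x <ᶠ blockOf y
    blockOf-mono = block-mono q

    blockOf-embedding : IsEmbedding X (graph universal) blockOf
    blockOf-embedding = (λ {x} {y} eq → trans (≡-sym (strictlyInverseʳ r x)) (trans (cong (from r)
        (increasing⇒injective {f = block q} (λ i j → block-mono q) eq)) (strictlyInverseʳ r y))) , blockOf-adj

one-way⇒agree : ∀ {s p r} (f : Fin s → Fin p) (g : Fin s → Fin r) → Injective _≡_ _≡_ f →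
  (∀ x y → f x <ᶠ f y → g x <ᶠ g y) → ∀ x y → g x <ᶠ g y → f x <ᶠ f y
one-way⇒agree f g f-inj f⇒g x y gx<gy with <ᶠ-cmp (f x) (f y)
... | tri< fx<fy _ _ = fx<fy
... | tri≈ _ fx≡fy _ = ⊥-elim (<ᶠ-irrefl (cong g (f-inj fx≡fy)) gx<gy)
... | tri> _ _ fy<fx = ⊥-elim (<ᶠ-asym gx<gy (f⇒g y x fy<fx))

rank-injective : ∀ {n X} (e : Extension n X) → Injective _≡_ _≡_ (to (rank e))
rank-injective e = proj₁ (rank-embedding e)

colour<⇒rank< : ∀ {n X} (e : Extension n X) x y → colour e x <ᶠ colour e y → to (rank e) x <ᶠ to (rank e) y
colour<⇒rank< e x y cx<cy with <ᶠ-cmp (to (rank e) x) (to (rank e) y)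
... | tri< rx<ry _ _ = rx<ry
... | tri≈ _ rx≡ry _ = ⊥-elim (<ᶠ-irrefl (cong (colour e) (rank-injective e rx≡ry)) cx<cy)
... | tri> _ _ ry<rx = ⊥-elim (≤⇒≯ (monotone e y x ry<rx) cx<cy)

module _ {n : ℕ} {Z : Graph} (X : Graph) (eZ : Extension n Z) where
  induced-type : ∀ {h} (emb : IsEmbedding X Z h) (e : Extension n X) (f : Fin (size X) ↔ Fin (size X)) →
    (∀ x y → E X x y ≡ E X (to f x) (to f y)) →
    (∀ x y → to (rank eZ) (h x) <ᶠ to (rank eZ) (h y) → to (rank e) (to f x) <ᶠ to (rank e) (to f y)) →
    (∀ x → colour e (to f x) ≡ colour eZ (h x)) → induced X eZ h emb ≈ e
  induced-type {h} emb e f edges order colours = Isomorphic⇒≈ (f , edges ,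
    (λ x y → mk⇔ (λ lt → order x y (rank⇒key R x y lt))
      (λ lt → key⇒rank R x y (one-way⇒agree (to (rank eZ) ∘ h) (to (rank e) ∘ to f)
        (proj₁ emb ∘ rank-injective eZ) order x y lt))) , colours)
    where R = inducedRanking X eZ h emb

  -- Two enumerations of one vertex set differ by an automorphism of X, which is an isomorphism of
  -- the induced extensions.
  same-copy⇒≈ : ∀ {S} (p q : IsCopy X Z S) →
    induced X eZ (proj₁ p) (proj₁ (proj₂ p)) ≈ induced X eZ (proj₁ q) (proj₁ (proj₂ q))
  same-copy⇒≈ {S} p@(f , f-emb , f-mem) q@(g , g-emb , g-mem) = induced-type f-emb (induced X eZ g g-emb)
    (proj₁ (injective⇒↔ h (proj₁ h-emb))) (proj₂ h-emb)
    (λ x y lt → key⇒rank (inducedRanking X eZ g g-emb) (h x) (h y)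
      (subst₂ (λ u v → to (rank eZ) u <ᶠ to (rank eZ) v) (≡-sym (h-eq x)) (≡-sym (h-eq y)) lt))
    (λ x → cong (colour eZ) (h-eq x))
    where
    S⊆ : S ⊆ image g
    S⊆ = subst (_⊆ image g) (≡-sym (copy-image X Z q)) id
    h = factor X X Z g-emb p S⊆
    h-eq = factor-eq X X Z g-emb p S⊆
    h-emb = factor-embedding X X Z g-emb p S⊆

  typeColouring : CopyColouring X Z (number (extensions n X))
  typeColouring = record
    { col = λ S p → proj₁ (classify n X (type p))
    ; witness-irrelevant = λ S p q → distinct (extensions n X) _ _
        (≈-trans (≈-sym (proj₂ (classify n X (type p))))
          (≈-trans (same-copy⇒≈ p q) (proj₂ (classify n X (type q)))))
    }
    where
    type : ∀ {S} → IsCopy X Z S → Extension n X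
    type p = induced X eZ (proj₁ p) (proj₁ (proj₂ p))

flip : ∀ {s} → Fin 2 → Fin s → Fin s
flip zero    = opposite
flip (suc _) = id

flip-injective : ∀ {s} b {x y : Fin s} → flip b x ≡ flip b y → x ≡ y
flip-injective zero    {x} {y} eq = trans (≡-sym (opposite-involutive x)) (trans (cong opposite eq) (opposite-involutive y))
flip-injective (suc _) eq = eq

toBit-true : ∀ {P : Set} (d : Dec P) → toBit (does d) ≡ suc zero → P
toBit-true (yes p) _ = p

toBit-false : ∀ {P : Set} (d : Dec P) → toBit (does d) ≡ zero → ¬ P
toBit-false (no ¬p) _ = ¬p

-- The order on the class i is kept if ε i is 1 and reversed if ε i is 0.
record Distorted {n w : ℕ} (W : Partite n w) {Z : Graph} (eZ : Extension n Z) (ψ : Fin w → Fin (size Z)) : Set where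
  field
    distorted-embedding : IsEmbedding (graph W) Z ψ
    σ                   : Fin n → Fin n
    ε                   : Fin n → Fin 2
    distorted-colour    : ∀ v → colour eZ (ψ v) ≡ σ (part W v)
    distorted-order     : ∀ u v → u <ᶠ v → part W u ≡ part W v →
      toBit (does (to (rank eZ) (ψ u) <ᶠ? to (rank eZ) (ψ v))) ≡ ε (part W u)

ContainsTypes : ∀ {n w} → Graph → Partite n w → Set
ContainsTypes {n} {w} X W = ∀ {Z} (eZ : Extension n Z) {ψ} → Distorted W eZ ψ → (e : Extension n X) →
  Σ (Fin (size X) → Fin w) λ j → Σ (IsEmbedding X Z (ψ ∘ j)) λ emb → induced X eZ (ψ ∘ j) emb ≈ e

module _ {n : ℕ} (X : Graph) where
  open Universal n X

  -- The version of e permuted by the inverse of σ and reversed where ε is zero is one of the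
  -- blocks; its image under ψ is a copy of e.
  universal-contains : ContainsTypes X universal
  universal-contains {Z} eZ {Φ} D e = j , J-emb ,
    induced-type X eZ J-emb e (↔-id _) (λ x y → refl) (one-way⇒agree (to (rank e)) (to (rank eZ) ∘ Φ ∘ j) (rank-injective e) order)
      (λ x → ≡-sym (J-colour x))
    where
    open Distorted D renaming (distorted-embedding to Φ-emb; distorted-colour to Φ-colour; distorted-order to Φ-order)

    σ-injective : Injective _≡_ _≡_ σ
    σ-injective {d} {d′} eq with d ≟ᶠ d′
    ... | yes d≡d′ = d≡d′
    ... | no d≢d′ = ⊥-elim (proper eZ (Φ (clique d)) (Φ (clique d′))
      (trans (≡-sym (proj₂ Φ-emb (clique d) (clique d′))) (clique-adj d d′ d≢d′))
      (trans (colour-clique d) (trans eq (≡-sym (colour-clique d′)))))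
      where
      colour-clique : ∀ d → colour eZ (Φ (clique d)) ≡ σ d
      colour-clique d = trans (Φ-colour (clique d)) (cong (σ ∘ vpart) (view-clique d))

    g = proj₁ (injective⇒↔ σ σ-injective)

    c : Fin (size X) → Fin n
    c x = from g (colour e x)

    σ-c : ∀ x → σ (c x) ≡ colour e x
    σ-c x = strictlyInverseˡ g (colour e x)

    c-proper : ProperColouring n X c
    c-proper x y xy eq = proper e x y xy (trans (≡-sym (σ-c x)) (trans (cong σ eq) (σ-c y)))

    key : Fin (size X) → Fin (n * size X)
    key x = combine (c x) (flip (ε (c x)) (to (rank e) x))

    key-injective : Injective _≡_ _≡_ key
    key-injective {x} {y} eq = rank-injective e (flip-injective (ε (c x))
      (trans (combine-injectiveʳ (c x) _ (c y) _ eq)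
        (cong (λ d → flip (ε d) (to (rank e) y)) (≡-sym (combine-injectiveˡ (c x) _ (c y) _ eq)))))

    R = ranking key key-injective
    j = blockOf c c-proper (ranks R)

    J-emb : IsEmbedding X Z (Φ ∘ j)
    J-emb = embedding-∘ X (graph universal) Z (blockOf-embedding c c-proper (ranks R)) Φ-emb

    j-part : ∀ x → part universal (j x) ≡ c x
    j-part = blockOf-part c c-proper (ranks R)

    J-colour : ∀ x → colour eZ (Φ (j x)) ≡ colour e x
    J-colour x = trans (Φ-colour (j x)) (trans (cong σ (j-part x)) (σ-c x))

    key-mono : ∀ {x y} → c x ≡ c y → flip (ε (c x)) (to (rank e) x) <ᶠ flip (ε (c x)) (to (rank e) y) → j x <ᶠ j y
    key-mono {x} {y} eq lt = blockOf-mono c c-proper (ranks R) (key⇒rank R x y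
      (subst (λ d → combine (c x) (flip (ε (c x)) (to (rank e) x)) <ᶠ combine d (flip (ε d) (to (rank e) y))) eq
        (combine-monoʳ-< (c x) lt)))

    bit-of : ∀ {x y} → c x ≡ c y → j x <ᶠ j y → toBit (does (to (rank eZ) (Φ (j x)) <ᶠ? to (rank eZ) (Φ (j y)))) ≡ ε (c x)
    bit-of {x} {y} eq lt = trans (Φ-order (j x) (j y) lt (trans (j-part x) (trans eq (≡-sym (j-part y))))) (cong ε (j-part x))

    class-order : ∀ x y b → ε (c x) ≡ b → c x ≡ c y → to (rank e) x <ᶠ to (rank e) y →
      to (rank eZ) (Φ (j x)) <ᶠ to (rank eZ) (Φ (j y))
    class-order x y (suc zero) ε≡ eq lt = toBit-true (_ <ᶠ? _) (trans (bit-of eq (key-mono eq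
      (subst (λ b → flip b (to (rank e) x) <ᶠ flip b (to (rank e) y)) (≡-sym ε≡) lt))) ε≡)
    -- In a reversed class `j y` precedes `j x`, and the bit zero says that Z does not keep this
    -- order; so Z puts the image of `x` first.
    class-order x y zero ε≡ eq lt with <ᶠ-cmp (to (rank eZ) (Φ (j x))) (to (rank eZ) (Φ (j y)))
    ... | tri< l _ _ = l
    ... | tri≈ _ r≡ _ = ⊥-elim (<ᶠ-irrefl (cong (to (rank e)) (proj₁ J-emb (rank-injective eZ r≡))) lt)
    ... | tri> _ _ l = ⊥-elim (toBit-false (_ <ᶠ? _) (trans (bit-of (≡-sym eq) (key-mono (≡-sym eq)
      (subst (λ b → flip b (to (rank e) y) <ᶠ flip b (to (rank e) x)) (≡-sym ε-y) (opposite-anti lt)))) ε-y) l)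
      where
      ε-y : ε (c y) ≡ zero
      ε-y = trans (cong ε (≡-sym eq)) ε≡

    order : ∀ x y → to (rank e) x <ᶠ to (rank e) y → to (rank eZ) (Φ (j x)) <ᶠ to (rank eZ) (Φ (j y))
    -- Between different colours the order in Z is forced by monotonicity; only within one colour
    -- does ε matter.
    order x y lt with m≤n⇒m<n∨m≡n (monotone e x y lt)
    ... | inj₁ cx<cy = colour<⇒rank< eZ (Φ (j x)) (Φ (j y)) (subst₂ _<ᶠ_ (≡-sym (J-colour x)) (≡-sym (J-colour y)) cx<cy)
    ... | inj₂ cx≡cy = class-order x y (ε (c x)) refl (cong (from g) (toℕ-injective cx≡cy)) lt

-- The points of W₁ are homogenised with respect to their colour in Z, then the pairs of points
-- of W within a class with respect to their order in Z.
module _ {n w w₁ w₂ : ℕ} (W : Partite (suc n) w) (W₁ : Partite (suc n) w₁) (Y : Partite (suc n) w₂)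
         (hom₁ : (χ : ∀ i → EmbeddingColouring (isolated 2 i) W₁ 2) →
           (∀ i → Extensional (isolated 2 i) W₁ (χ i)) → Homogeneous (isolated 2) W W₁ χ)
         (hom₂ : (χ : ∀ i → EmbeddingColouring (isolated 1 i) Y (suc n)) →
           (∀ i → Extensional (isolated 1 i) Y (χ i)) → Homogeneous (isolated 1) W₁ Y χ)
         {Z : Graph} (eZ : Extension (suc n) Z) (φ : Fin w₂ → Fin (size Z)) (φ-emb : IsEmbedding (graph Y) Z φ) where
  open Homogeneous

  private
    c = colour eZ

    H₂ : Homogeneous (isolated 1) W₁ Y (λ _ g _ → c (φ (g zero)))
    H₂ = hom₂ _ (λ _ g h _ _ g≗h → cong (c ∘ φ) (g≗h zero))

    φ₁ : Fin w₁ → Fin (size Z)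
    φ₁ = φ ∘ copy H₂

    earlier : Fin w₁ → Fin w₁ → Fin 2
    earlier x y = toBit (does (to (rank eZ) (φ₁ x) <ᶠ? to (rank eZ) (φ₁ y)))

    H₁ : Homogeneous (isolated 2) W W₁ (λ _ g _ → earlier (g zero) (g (suc zero)))
    H₁ = hom₁ _ (λ _ g h _ _ g≗h → cong₂ earlier (g≗h zero) (g≗h (suc zero)))

    point-emb : ∀ x → IsEmbedding (graph (isolated 1 (part W₁ x))) (graph Y) (λ _ → copy H₂ x)
    point-emb x = embedding-∘ (graph (isolated 1 (part W₁ x))) (graph W₁) (graph Y)
      (monotone-embedding (point-monotone W₁ x)) (embedding H₂)

    two-emb : ∀ u v → u <ᶠ v → part W u ≡ part W v →
      IsEmbedding (graph (isolated 2 (part W u))) (graph W₁) (copy H₁ ∘ two u v)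
    two-emb u v u<v eq = embedding-∘ (graph (isolated 2 (part W u))) (graph W) (graph W₁)
      (monotone-embedding (two-monotone W u<v eq)) (embedding H₁)

  homogenised : Fin w → Fin w₂
  homogenised = copy H₂ ∘ copy H₁

  homogenised-distorted : Distorted W eZ (φ ∘ homogenised)
  homogenised-distorted = record
    { distorted-embedding = embedding-∘ (graph W) (graph Y) Z
        (embedding-∘ (graph W) (graph W₁) (graph Y) (embedding H₁) (embedding H₂)) φ-emb
    ; σ = colourOf H₂
    ; ε = colourOf H₁
    ; distorted-colour = λ v → trans
        (constant H₂ (part W₁ (copy H₁ v)) (λ _ → copy H₁ v) (point-monotone W₁ (copy H₁ v)) (point-emb (copy H₁ v)))
        (cong (colourOf H₂) (part-copy H₁ v))
    ; distorted-order = λ u v u<v eq →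
        constant H₁ (part W u) (two u v) (two-monotone W u<v eq) (two-emb u v u<v eq)
    }

-- Copies of X in Z are coloured by their type with respect to a fixed extension of Z. Every copy of
-- Y in Z contains a distorted W, hence copies of X of all types, and so sees every colour.
all-types : ∀ {n w r} X (W : Partite n w) → ContainsTypes X W → (Y : Partite n r) →
  (∀ {Z} (eZ : Extension n Z) φ → IsEmbedding (graph Y) Z φ → Σ (Fin w → Fin r) λ ψ → Distorted W eZ (φ ∘ ψ)) →
  ∀ {t} → RamseyBound n X t → number (extensions n X) ≤ t
all-types {n} X W contains Y distort {t} bound = conclude (bound (graph Y) (part Y , adj-part Y) τ)
  where
  τ = number (extensions n X)

  conclude : (Σ Graph λ Z → Colourable n Z × Arrow Z (graph Y) X τ t) → τ ≤ t
  conclude (Z , (c , c-proper) , arrow) = conclude′ (arrow (typeColouring X eZ))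
    where
    eZ = sortedBy Z c c-proper

    conclude′ : (Σ (Subset (size Z)) λ T → IsCopy (graph Y) Z T × Σ (Subset τ) λ C → ∣ C ∣ ≤ t ×
      (∀ S (p : IsCopy X Z S) → S ⊆ T → col (typeColouring X eZ) S p ∈ C)) → τ ≤ t
    conclude′ (T , (φ , φ-emb , φ-mem) , C , ∣C∣≤t , col∈C) =
      ≤-trans (≤-reflexive (≡-sym (∣⊤∣≡n τ))) (≤-trans (p⊆q⇒∣p∣≤∣q∣ {p = ⊤} {C} (λ {i} _ → every i)) ∣C∣≤t)
      where
      ψ = proj₁ (distort eZ φ φ-emb)

      every : ∀ i → i ∈ C
      every i = subst (_∈ C)
        (distinct (extensions n X) _ _ (≈-trans (≈-sym (proj₂ (classify n X (induced X eZ (φ ∘ ψ ∘ j) J-emb)))) J≈))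
        (col∈C (image (φ ∘ ψ ∘ j)) (image-copy X Z J-emb)
          (λ {z} z∈ → let x , eq = ∈-comprehension⁻ (preimage? (φ ∘ ψ ∘ j)) z∈ in
            Equivalence.from (φ-mem z) (ψ (j x) , eq)))
        where
        found = contains eZ (proj₂ (distort eZ φ φ-emb)) (rep (extensions n X) i)
        j = proj₁ found
        J-emb = proj₁ (proj₂ found)
        J≈ = proj₂ (proj₂ found)

lower-bound : ∀ n X t → RamseyBound (suc n) X t → number (extensions (suc n) X) ≤ t
lower-bound n X t = from-universal (universal (suc n) X) (universal-contains X)
  where
  open Universal using (universal)

  from-universal : ∀ {w} (W : Partite (suc n) w) → ContainsTypes X W → RamseyBound (suc n) X t →
    number (extensions (suc n) X) ≤ t
  from-universal W contains =
    -- The last argument of `partite-ramsey` is one less than the number of colours: two for the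
    -- order of a pair, and n + 1 for the colour of a point.
    let _ , W₁ , hom₁ = partite-ramsey (isolated 2) W 1
        _ , Y , hom₂ = partite-ramsey (isolated 1) W₁ n
    in all-types X W contains Y λ eZ φ φ-emb →
      homogenised W W₁ Y hom₁ hom₂ eZ φ φ-emb , homogenised-distorted W W₁ Y hom₁ hom₂ eZ φ φ-emb

theorem1p4 : (n : ℕ) → n ≥ 1 → (X : Graph) → Colourable n X →
    Σ ℕ λ t → IsTau n X t × RamseyDegree n X t
theorem1p4 (suc n) _ X _ = number (extensions (suc n) X) , isTau (suc n) X , upper-bound (suc n) X , lower-bound n X
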